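{- Let $H = (V,E)$ be a hypertree such that $|e|$ is prime for each $e \in E$. Then the chromatic symmetric function $X_H$ is $F$-positive.
   Context: A hypergraph is a pair $H=(V,E)$ with $V$ finite and $E$ a family of subsets of $V$ with $|e|>1$ for each $e\in E$. A path is a sequence $v_1, e_1, v_2, \ldots, e_m, v_{m+1}$ with $e_i \in E$, $v_i, v_{i+1} \in e_i$, the edges distinct and the vertices distinct except that $v_1 = v_{m+1}$ is allowed; if $v_1 = v_{m+1}$ and $m>1$ it is a cycle. A hypertree is a connected (any two vertices joined by a path) hypergraph with no cycles. A coloring $\chi: V \to \mathbb{P}=\{1,2,\ldots\}$ is proper if no edge is monochromatic (i.e. $\chi$ is nonconstant on each $e\in E$). $X_H = \sum_\chi \prod_{v \in V} x_{\chi(v)}$, summed over proper colorings, a symmetric function in commuting variables $x_1,x_2,\ldots$. With $n=|V|$, for $S \subseteq [n-1]$ the fundamental quasisymmetric function is $F_S = \sum x_{i_1}\cdots x_{i_n}$ over all $i_1 \le \cdots \le i_n$ in $\mathbb{P}$ with $i_j < i_{j+1}$ whenever $j \in S$. $X_H$ is $F$-positive if all coefficients in its expansion $X_H = \sum_S a_S F_S$ are nonnegative. -}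

module Defs where

open import Data.Bool using (true; false)
open import Data.Fin as Fin using (Fin; zero; suc; inject₁; fromℕ)
open import Data.Fin.Properties using (all?)
open import Data.Fin.Subset using (Subset; ∣_∣; inside; outside) renaming (_∈_ to _∈ₛ_)
open import Data.Fin.Subset.Properties using () renaming (_∈?_ to _∈ₛ?_)
open import Data.Integer as ℤ using (ℤ; +_; 0ℤ)
open import Data.List as List using (List; []; _∷_; length; filter; upTo; applyUpTo; cartesianProductWith)
open import Data.List.Membership.Propositional using (_∈_)
open import Data.List.Membership.Propositional.Properties using (∈-cartesianProductWith⁺; ∈-cartesianProductWith⁻; ∈-filter⁺; ∈-filter⁻; ∈-upTo⁺; ∈-upTo⁻)
open import Data.List.Properties using (≡-dec; ∷-injective)
open import Data.List.Relation.Unary.All as All using ()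
open import Data.List.Relation.Unary.AllPairs using ([]; _∷_)
open import Data.List.Relation.Unary.Any using (here; there)
open import Data.List.Relation.Unary.Unique.Propositional using (Unique)
open import Data.List.Relation.Unary.Unique.Propositional.Properties using (cartesianProductWith⁺; filter⁺; upTo⁺)
open import Data.Nat using (ℕ; zero; suc; _∸_; _≤_; _<_; s≤s; _≟_; _≤?_; _<?_)
open import Data.Nat.Properties using (≮⇒≥; <⇒≢; <-≤-trans)
open import Data.Product using (∃; Σ; _×_; _,_; proj₁; proj₂)
open import Data.Unit using (⊤; tt)
open import Data.Vec as Vec using (Vec; []; _∷_; lookup; count)
import Data.Vec.Properties as Vecₚ
open import Data.Vec.Relation.Unary.All using ([]; _∷_) renaming (All to Allᵥ)
open import Function using (_∘_; Injective)
open import Relation.Binary.PropositionalEquality using (_≡_; _≢_; refl; sym; trans)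
open import Relation.Nullary using (Dec; yes; no; ¬_; ¬?; contradiction; _×-dec_; _→-dec_)
open import Relation.Unary using (Pred; Decidable)
open import Level using (0ℓ)

-- The vertex set is Fin n.  The edges form an indexed family, so two edges are
-- distinct when their indices are.
record Hypergraph (n : ℕ) : Set where
  field
    edgeCount : ℕ
    edge      : Fin edgeCount → Subset n
    edge-size : ∀ e → 1 < ∣ edge e ∣

open Hypergraph public

record Path {n} (H : Hypergraph n) (m : ℕ) : Set where
  field
    vertex          : Fin (suc m) → Fin n
    pathEdge        : Fin m → Fin (edgeCount H)
    left∈           : ∀ i → vertex (inject₁ i) ∈ₛ edge H (pathEdge i)
    right∈          : ∀ i → vertex (suc i) ∈ₛ edge H (pathEdge i)
    edges-distinct  : Injective _≡_ _≡_ pathEdge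
    -- Only the first and the last vertex may coincide.
    vertices-distinct : ∀ i j → i Fin.< j → vertex i ≡ vertex j →
                        i ≡ zero × j ≡ fromℕ m

  source target : Fin n
  source = vertex zero
  target = vertex (fromℕ m)

open Path public

IsCycle : ∀ {n} {H : Hypergraph n} {m} → Path H m → Set
IsCycle {m = m} p = 1 < m × source p ≡ target p

Connected : ∀ {n} → Hypergraph n → Set
Connected {n} H = (u v : Fin n) → ∃ λ m → Σ (Path H m) λ p → source p ≡ u × target p ≡ v

Acyclic : ∀ {n} → Hypergraph n → Set
Acyclic H = ∀ m (p : Path H m) → ¬ IsCycle p

record IsHypertree {n} (H : Hypergraph n) : Set where
  field
    connected : Connected H
    acyclic   : Acyclic H

open IsHypertree public

-- Colours and variable indices are shifted by one: c : ℕ stands for c + 1 ∈ ℙ.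
Coloring : ℕ → Set
Coloring n = Vec ℕ n

Monochromatic : ∀ {n} → Coloring n → Subset n → Set
Monochromatic χ e = ∀ u → u ∈ₛ e → ∀ v → v ∈ₛ e → lookup χ u ≡ lookup χ v

Proper : ∀ {n} → Hypergraph n → Pred (Coloring n) 0ℓ
Proper H χ = ∀ e → ¬ Monochromatic χ (edge H e)

monochromatic? : ∀ {n} (χ : Coloring n) (e : Subset n) → Dec (Monochromatic χ e)
monochromatic? χ e =
  all? λ u → (u ∈ₛ? e) →-dec all? λ v → (v ∈ₛ? e) →-dec (lookup χ u ≟ lookup χ v)

proper? : ∀ {n} (H : Hypergraph n) → Decidable (Proper H)
proper? H χ = all? λ e → ¬? (monochromatic? χ (edge H e))

-- The list α₀ ∷ α₁ ∷ … ∷ α₍ₖ₋₁₎ ∷ [] is the monomial x₁^α₀ x₂^α₁ ⋯ xₖ^α₍ₖ₋₁₎;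
-- appending zeros to the list does not change the monomial.
Monomial : Set
Monomial = List ℕ

exponent : Monomial → ℕ → ℕ
exponent []      _       = 0
exponent (a ∷ _) zero    = a
exponent (_ ∷ α) (suc c) = exponent α c

-- A formal power series in x₁, x₂, …, given by its coefficients.
PowerSeries : Set
PowerSeries = Monomial → ℤ

multiplicity : ∀ {n} → Vec ℕ n → ℕ → ℕ
multiplicity w c = count (c ≟_) w

vectors : {A : Set} → List A → (n : ℕ) → List (Vec A n)
vectors xs zero    = [] ∷ []
vectors xs (suc n) = cartesianProductWith _∷_ xs (vectors xs n)

-- The words w satisfying P with ∏ᵢ x_{wᵢ} = α; see ∈-terms⁺, ∈-terms⁻ and
-- terms-unique below.  No letter of such a word exceeds the number of variables
-- listed in α, so a finite search finds them all.
terms : ∀ {n} {P : Pred (Vec ℕ n) 0ℓ} → Decidable P → Monomial → List (Vec ℕ n)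
terms {n} P? α =
  filter (λ w → P? w ×-dec ≡-dec _≟_ (applyUpTo (multiplicity w) (length α)) α)
         (vectors (upTo (length α)) n)

-- Σ x_{w₁} ⋯ x_{wₙ} over all words w ∈ ℙⁿ satisfying P.
wordSeries : ∀ {n} {P : Pred (Vec ℕ n) 0ℓ} → Decidable P → PowerSeries
wordSeries P? α = + length (terms P? α)

chromaticSymmetricFunction : ∀ {n} → Hypergraph n → PowerSeries
chromaticSymmetricFunction H = wordSeries (proper? H)

-- j : Fin (n ∸ 1) stands for j + 1 ∈ [n - 1].
Compatible : ∀ {n} → Subset (n ∸ 1) → Pred (Vec ℕ n) 0ℓ
Compatible {zero}  S w = ⊤
Compatible {suc _} S w = ∀ j →
  lookup w (inject₁ j) ≤ lookup w (suc j) ×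
  (j ∈ₛ S → lookup w (inject₁ j) < lookup w (suc j))

compatible? : ∀ {n} (S : Subset (n ∸ 1)) → Decidable (Compatible {n} S)
compatible? {zero}  S w = yes tt
compatible? {suc _} S w = all? λ j →
  (lookup w (inject₁ j) ≤? lookup w (suc j)) ×-dec
  ((j ∈ₛ? S) →-dec (lookup w (inject₁ j) <? lookup w (suc j)))

fundamental : ∀ n → Subset (n ∸ 1) → PowerSeries
fundamental n S = wordSeries (compatible? {n} S)

subsets : ∀ m → List (Subset m)
subsets = vectors (inside ∷ outside ∷ [])

sumℤ : List ℤ → ℤ
sumℤ = List.foldr ℤ._+_ 0ℤ

IsFExpansion : ∀ n → PowerSeries → (Subset (n ∸ 1) → ℤ) → Set
IsFExpansion n f a =
  ∀ α → f α ≡ sumℤ (List.map (λ S → a S ℤ.* fundamental n S α) (subsets (n ∸ 1)))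

-- For series homogeneous of degree n.  The F_S are linearly independent, so
-- there is at most one expansion.
FPositive : ∀ n → PowerSeries → Set
FPositive n f = ∃ λ a → IsFExpansion n f a × (∀ S → 0ℤ ℤ.≤ a S)

module _ {A : Set} {xs : List A} where

  ∈-vectors⁺ : ∀ {n} {w : Vec A n} → Allᵥ (_∈ xs) w → w ∈ vectors xs n
  ∈-vectors⁺ []       = here refl
  ∈-vectors⁺ (p ∷ ps) = ∈-cartesianProductWith⁺ _∷_ p (∈-vectors⁺ ps)

  ∈-vectors⁻ : ∀ {n} {w : Vec A n} → w ∈ vectors xs n → Allᵥ (_∈ xs) w
  ∈-vectors⁻ {zero}  {[]} _ = []
  ∈-vectors⁻ {suc n} w∈
    with _ , _ , p , q , refl ← ∈-cartesianProductWith⁻ _∷_ xs (vectors xs n) w∈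
    = p ∷ ∈-vectors⁻ q

  vectors-unique : Unique xs → ∀ n → Unique (vectors xs n)
  vectors-unique u zero    = All.[] ∷ []
  vectors-unique u (suc n) =
    cartesianProductWith⁺ _∷_ Vecₚ.∷-injective u (vectors-unique u n)

∈-subsets : ∀ {m} (S : Subset m) → S ∈ subsets m
∈-subsets S = ∈-vectors⁺ (sides S)
  where
  sides : ∀ {m} (S : Subset m) → Allᵥ (_∈ inside ∷ outside ∷ []) S
  sides []          = []
  sides (true ∷ S)  = here refl ∷ sides S
  sides (false ∷ S) = there (here refl) ∷ sides S

subsets-unique : ∀ m → Unique (subsets m)
subsets-unique = vectors-unique (((λ ()) All.∷ All.[]) ∷ (All.[] ∷ []))

private
  exponent-≥ : ∀ α {c} → length α ≤ c → exponent α c ≡ 0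
  exponent-≥ []      _         = refl
  exponent-≥ (_ ∷ α) (s≤s α≤c) = exponent-≥ α α≤c

  applyUpTo-exponent : ∀ α (f : ℕ → ℕ) → (∀ c → f c ≡ exponent α c) →
                       applyUpTo f (length α) ≡ α
  applyUpTo-exponent []      f eq = refl
  applyUpTo-exponent (a ∷ α) f eq
    rewrite eq 0 | applyUpTo-exponent α (f ∘ suc) (eq ∘ suc) = refl

  exponent-applyUpTo : ∀ α (f : ℕ → ℕ) → applyUpTo f (length α) ≡ α →
                       ∀ {c} → c < length α → f c ≡ exponent α c
  exponent-applyUpTo (_ ∷ α) f eq {zero}  _         = proj₁ (∷-injective eq)
  exponent-applyUpTo (_ ∷ α) f eq {suc c} (s≤s c<k) =
    exponent-applyUpTo α (f ∘ suc) (proj₂ (∷-injective eq)) c<k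

  module _ {Q : Pred ℕ 0ℓ} (Q? : Decidable Q) {n} (x : ℕ) (w : Vec ℕ n) where

    count-yes : Q x → count Q? (x ∷ w) ≢ 0
    count-yes q eq with Q? x
    ... | yes _ with () ← eq
    ... | no ¬q = ¬q q

    count-no : ¬ Q x → count Q? (x ∷ w) ≡ count Q? w
    count-no ¬q with Q? x
    ... | yes q = contradiction q ¬q
    ... | no _  = refl

    count-tail : count Q? (x ∷ w) ≡ 0 → count Q? w ≡ 0
    count-tail eq with Q? x
    ... | yes _ with () ← eq
    ... | no _  = eq

  letters-< : ∀ {n k} (w : Vec ℕ n) → (∀ {c} → k ≤ c → multiplicity w c ≡ 0) →
              Allᵥ (_∈ upTo k) w
  letters-< [] _ = []
  letters-< {k = k} (x ∷ w) z with x <? k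
  ... | yes x<k = ∈-upTo⁺ x<k ∷ letters-< w (λ {c} k≤c → count-tail (c ≟_) x w (z k≤c))
  ... | no  x≮k = contradiction (z (≮⇒≥ x≮k)) (count-yes (x ≟_) x w refl)

  multiplicity-≥ : ∀ {n k} {w : Vec ℕ n} → Allᵥ (_∈ upTo k) w →
                   ∀ {c} → k ≤ c → multiplicity w c ≡ 0
  multiplicity-≥ []       _ = refl
  multiplicity-≥ {w = x ∷ w} (p ∷ ps) {c} k≤c =
    trans (count-no (c ≟_) x w (λ c≡x → <⇒≢ (<-≤-trans (∈-upTo⁻ p) k≤c) (sym c≡x)))
          (multiplicity-≥ ps k≤c)

module _ {n} {P : Pred (Vec ℕ n) 0ℓ} (P? : Decidable P) (α : Monomial) where

  ∈-terms⁺ : ∀ {w} → P w → (∀ c → multiplicity w c ≡ exponent α c) → w ∈ terms P? α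
  ∈-terms⁺ {w} pw eq = ∈-filter⁺ _
    (∈-vectors⁺ (letters-< w (λ {c} k≤c → trans (eq c) (exponent-≥ α k≤c))))
    (pw , applyUpTo-exponent α (multiplicity w) eq)

  ∈-terms⁻ : ∀ {w} → w ∈ terms P? α → P w × (∀ c → multiplicity w c ≡ exponent α c)
  ∈-terms⁻ {w} w∈
    with w∈v , pw , eq ← ∈-filter⁻ (λ w → P? w ×-dec ≡-dec _≟_ (applyUpTo (multiplicity w) (length α)) α) {xs = vectors (upTo (length α)) n} w∈
    = pw , agree
    where
    agree : ∀ c → multiplicity w c ≡ exponent α c
    agree c with c <? length α
    ... | yes c<k = exponent-applyUpTo α (multiplicity w) eq c<k
    ... | no  c≮k = trans (multiplicity-≥ (∈-vectors⁻ w∈v) (≮⇒≥ c≮k))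
                          (sym (exponent-≥ α (≮⇒≥ c≮k)))

  terms-unique : Unique (terms P? α)
  terms-unique = filter⁺ _ (vectors-unique (upTo⁺ (length α)) n)

{-# OPTIONS --safe #-}

-- Let w be a nonconstant word of prime length p with d cyclic descents.  Rotating
-- w once changes its major index by - d modulo p, and 0 < d < p, so exactly one of
-- the p rotations of w has major index ≡ - 1 (mod p).  All rotations of a constant
-- word have major index 0.  Hence the proper colorings of H are partitioned
-- according to which rotation of the vertices of each edge makes the major index of
-- the colors ≡ - 1.  As H is acyclic, any choice of one linear order per edge
-- extends to a linear order of all vertices; breaking ties between equal colors by
-- this order for the chosen rotations, membership in a block of the partition
-- depends only on the standardization of the coloring.  The colorings with a given
-- standardization contribute one fundamental quasisymmetric function.
module Submission where

open import Defs
open import Algebra.Properties.CommutativeSemigroup using (interchange)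
open import Data.Bool using (true; false; if_then_else_)
open import Data.Bool.Properties using () renaming (_≟_ to _≟ᵇ_)
open import Data.Fin as Fin using (Fin; zero; suc; toℕ; fromℕ; fromℕ<; inject₁; punchOut)
import Data.Fin.Properties as Finₚ
open import Data.Fin.Subset using (Subset; ∣_∣) renaming (_∈_ to _∈ₛ_)
open import Data.Fin.Subset.Properties using (p⊂q⇒∣p∣<∣q∣; ∣⊤∣≡n; ∣p∣≤n; ∈⊤) renaming (_∈?_ to _∈ₛ?_)
open import Data.Integer as ℤ using (ℤ; +_; 0ℤ; 1ℤ)
import Data.Integer.Properties as ℤₚ
open import Data.List as List using (List; []; _∷_; length; map; _∷ʳ_; filter; allFin; upTo; cartesianProduct)
open import Data.List.Membership.Propositional using (_∈_)
open import Data.List.Membership.Propositional.Properties using (∈-map⁺; ∈-map⁻; ∈-tabulate⁺; ∈-allFin; ∈-upTo⁺; ∈-cartesianProduct⁺)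
open import Data.List.Membership.Propositional.Properties.WithK using (unique∧set⇒bag)
open import Data.List.Properties using (length-++; map-++; length-map; map-tabulate)
open import Data.List.Relation.Binary.BagAndSetEquality using (∼bag⇒↭)
open import Data.List.Relation.Binary.Permutation.Propositional using (_↭_; ↭-refl; ↭-sym; ↭-trans; ↭⇒↭ₛ)
open import Data.List.Relation.Binary.Permutation.Propositional.Properties using (∷↭∷ʳ; ∈-resp-↭; ↭-length; filter-↭) renaming (map⁺ to ↭-map⁺)
import Data.List.Relation.Binary.Permutation.Setoid.Properties as ↭ₛ
open import Data.List.Relation.Unary.All as All using (All; []; _∷_)
open import Data.List.Relation.Unary.AllPairs as AllPairs using (AllPairs; []; _∷_)
open import Data.List.Relation.Unary.Any using (here; there)
open import Data.List.Relation.Unary.Unique.Propositional using (Unique)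
import Data.List.Relation.Unary.Unique.Propositional.Properties as Uniqueₚ
open import Data.Nat
open import Data.Nat.Divisibility
open import Data.Nat.DivMod
open import Data.Nat.Primality using (Prime; euclidsLemma; prime⇒nonZero; ¬prime[1])
open import Data.Nat.Properties
open import Data.Nat.Tactic.RingSolver using (solve-∀)
open import Data.Product using (∃; ∃₂; Σ; _×_; _,_; proj₁; proj₂)
open import Data.Sum using (_⊎_; inj₁; inj₂; [_,_]′)
open import Data.Unit using (⊤; tt)
open import Data.Vec using (Vec; []; _∷_; lookup; tabulate; count; here; there)
open import Data.Vec.Properties using (lookup∘tabulate; tabulate∘lookup; tabulate-cong; lookup⇒[]=; []=⇒lookup) renaming (≡-dec to ≡-decᵥ)
open import Data.Vec.Relation.Unary.All.Properties using () renaming (lookup⁻ to Allᵥ-lookup⁻)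
open import Function using (_∘_; Injective; id; mk⇔)
open import Level using (0ℓ)
open import Relation.Binary.Construct.Closure.ReflexiveTransitive using (Star; ε; _◅_; _◅◅_; reverse)
open import Relation.Binary.Definitions using (tri<; tri≈; tri>)
import Relation.Binary.Definitions as Binary
open import Relation.Binary.PropositionalEquality
open import Relation.Nullary
open import Relation.Nullary.Decidable using (dec-true; dec-false; map′)
open import Relation.Unary using (Pred; Decidable)

-- If `j` were missed, punching it out of the codomain would inject `Fin (suc n)` into `Fin n`.
injective⇒surjective : ∀ {n} (f : Fin n → Fin n) → Injective _≡_ _≡_ f → ∀ j → ∃ λ i → f i ≡ j
injective⇒surjective {suc n} f f-inj j with Finₚ.any? (λ i → f i Finₚ.≟ j)
... | yes hit  = hit
... | no  miss = contradiction
  (Finₚ.injective⇒≤ {f = λ i → punchOut {i = j} {f i} (λ j≡fi → miss (i , sym j≡fi))}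
    (λ {i} {i′} eq → f-inj (Finₚ.punchOut-injective (λ j≡fi → miss (i , sym j≡fi)) (λ j≡fi → miss (i′ , sym j≡fi)) eq)))
  1+n≰n

-- Words and their cyclic rotations

descent : ℕ → ℕ → ℕ
descent a b = if does (b <? a) then 1 else 0

descent-> : ∀ {a b} → b < a → descent a b ≡ 1
descent-> {a} {b} b<a rewrite dec-true (b <? a) b<a = refl

descent-≤ : ∀ {a b} → a ≤ b → descent a b ≡ 0
descent-≤ {a} {b} a≤b rewrite dec-false (b <? a) (≤⇒≯ a≤b) = refl

descent≤1 : ∀ a b → descent a b ≤ 1
descent≤1 a b with b <? a
... | yes b<a = ≤-reflexive (descent-> b<a)
... | no  b≮a = ≤-trans (≤-reflexive (descent-≤ (≮⇒≥ b≮a))) z≤n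

descents : ℕ → List ℕ → ℕ
descents a []      = 0
descents a (b ∷ w) = descent a b + descents b w

cyclicDescents : List ℕ → ℕ
cyclicDescents []      = 0
cyclicDescents (a ∷ w) = descents a (w ∷ʳ a)

majorFrom : ℕ → ℕ → List ℕ → ℕ
majorFrom i a []      = 0
majorFrom i a (b ∷ w) = i * descent a b + majorFrom (suc i) b w

major : List ℕ → ℕ
major []      = 0
major (a ∷ w) = majorFrom 1 a w

rotate₁ : {A : Set} → List A → List A
rotate₁ []      = []
rotate₁ (a ∷ w) = w ∷ʳ a

rotate : {A : Set} → ℕ → List A → List A
rotate zero    w = w
rotate (suc k) w = rotate₁ (rotate k w)

rotate-↭ : {A : Set} (k : ℕ) (w : List A) → rotate k w ↭ w
rotate-↭ zero    w = ↭-refl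
rotate-↭ (suc k) w = ↭-trans (rotate₁-↭ (rotate k w)) (rotate-↭ k w)
  where
  rotate₁-↭ : ∀ w → rotate₁ w ↭ w
  rotate₁-↭ []      = ↭-refl
  rotate₁-↭ (a ∷ w) = ↭-sym (∷↭∷ʳ a w)

rotate-unique : {A : Set} (k : ℕ) {w : List A} → Unique w → Unique (rotate k w)
rotate-unique {A} k {w} = ↭ₛ.Unique-resp-↭ (setoid A) (↭⇒↭ₛ (↭-sym (rotate-↭ k w)))

map-rotate : {A B : Set} (f : A → B) (k : ℕ) (w : List A) → map f (rotate k w) ≡ rotate k (map f w)
map-rotate f zero    w = refl
map-rotate f (suc k) w = trans (map-rotate₁ (rotate k w)) (cong rotate₁ (map-rotate f k w))
  where
  map-rotate₁ : ∀ w → map f (rotate₁ w) ≡ rotate₁ (map f w)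
  map-rotate₁ []      = refl
  map-rotate₁ (a ∷ w) = map-++ f w (a ∷ [])

-- Every position moves up by one, so each descent contributes one more.
majorFrom-suc : ∀ i a w → majorFrom (suc i) a w ≡ majorFrom i a w + descents a w
majorFrom-suc i a []      = refl
majorFrom-suc i a (b ∷ w) rewrite majorFrom-suc (suc i) b w =
  rearrange i (descent a b) (majorFrom (suc i) b w) (descents b w)
  where
  rearrange : ∀ i x y z → (x + i * x) + (y + z) ≡ (i * x + y) + (x + z)
  rearrange = solve-∀

-- The appended letter can only create a descent at the last position `i + length w`; `x` is 0 or 1
-- accordingly. For `i = 1` that position is the length of `a ∷ w`, so the change vanishes modulo
-- the length.
majorFrom-∷ʳ : ∀ i a w z → ∃ λ x → majorFrom i a (w ∷ʳ z) ≡ majorFrom i a w + x * (i + length w)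
majorFrom-∷ʳ i a []      z = descent a z , rearrange i (descent a z)
  where
  rearrange : ∀ i x → i * x + 0 ≡ x * (i + 0)
  rearrange = solve-∀
majorFrom-∷ʳ i a (b ∷ w) z with x , eq ← majorFrom-∷ʳ (suc i) b w z
  rewrite eq = x , rearrange i (length w) (descent a b) (majorFrom (suc i) b w) x
  where
  rearrange : ∀ i l d m x → i * d + (m + x * (suc i + l)) ≡ (i * d + m) + x * (i + suc l)
  rearrange = solve-∀

-- Rotating shifts every descent one place to the left, and a descent from the
-- last letter to the first one enters at position p - 1 ≡ - 1.
major-rotate₁ : ∀ w → ∃ λ x → major (rotate₁ w) + cyclicDescents w ≡ major w + x * length w
major-rotate₁ []      = 0 , refl
major-rotate₁ (a ∷ w) with x , eq ← majorFrom-∷ʳ 1 a w a = x , (begin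
  major (w ∷ʳ a) + descents a (w ∷ʳ a)           ≡⟨ cong (_+ descents a (w ∷ʳ a)) (from-zero w) ⟩
  majorFrom 0 a (w ∷ʳ a) + descents a (w ∷ʳ a)   ≡⟨ majorFrom-suc 0 a (w ∷ʳ a) ⟨
  majorFrom 1 a (w ∷ʳ a)                         ≡⟨ eq ⟩
  major (a ∷ w) + x * length (a ∷ w)             ∎)
  where
  open ≡-Reasoning
  -- Putting `a` in front is harmless when counting starts at 0: the new comparison gets weight 0
  -- and the others keep their weights.
  from-zero : ∀ w → major (w ∷ʳ a) ≡ majorFrom 0 a (w ∷ʳ a)
  from-zero []      = refl
  from-zero (b ∷ w) = refl

descents-∷ʳ-∷ʳ : ∀ b w a c → descents b (w ∷ʳ a ∷ʳ c) ≡ descents b (w ∷ʳ a) + descent a c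
descents-∷ʳ-∷ʳ b []      a c rewrite +-identityʳ (descent a c) | +-identityʳ (descent b a) = refl
descents-∷ʳ-∷ʳ b (x ∷ w) a c rewrite descents-∷ʳ-∷ʳ x w a c = sym (+-assoc (descent b x) _ _)

-- A rotation only moves the comparison of the first two letters from the front to the end.
cyclicDescents-rotate : ∀ k w → cyclicDescents (rotate k w) ≡ cyclicDescents w
cyclicDescents-rotate zero    w = refl
cyclicDescents-rotate (suc k) w = trans (step (rotate k w)) (cyclicDescents-rotate k w)
  where
  step : ∀ w → cyclicDescents (rotate₁ w) ≡ cyclicDescents w
  step []          = refl
  step (a ∷ [])    = refl
  step (a ∷ b ∷ w) = trans (descents-∷ʳ-∷ʳ b w a b) (+-comm (descents b (w ∷ʳ a)) _)

-- Iterates `major-rotate₁`: the number of cyclic descents is the same for all rotations, so every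
-- step lowers the major index by the same amount modulo the length. The loss stands on the left to
-- avoid subtraction.
major-rotate : ∀ j k w → ∃ λ x →
  major (rotate (j + k) w) + j * cyclicDescents w ≡ major (rotate k w) + x * length w
major-rotate zero    k w = 0 , refl
major-rotate (suc j) k w
  with x , eq ← major-rotate j k w
     | y , eq′ ← major-rotate₁ (rotate (j + k) w)
  rewrite cyclicDescents-rotate (j + k) w | ↭-length (rotate-↭ (j + k) w)
  = x + y , (begin
    M₂ + (d + j * d)            ≡⟨ +-assoc M₂ d (j * d) ⟨
    M₂ + d + j * d              ≡⟨ cong (_+ j * d) eq′ ⟩
    M₁ + y * l + j * d          ≡⟨ rearrange M₁ (y * l) (j * d) ⟩
    M₁ + j * d + y * l          ≡⟨ cong (_+ y * l) eq ⟩
    M₀ + x * l + y * l          ≡⟨ rearrange′ M₀ x y l ⟩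
    M₀ + (x + y) * l            ∎)
  where
  open ≡-Reasoning
  d = cyclicDescents w
  l = length w
  M₀ = major (rotate k w)
  M₁ = major (rotate (j + k) w)
  M₂ = major (rotate (suc j + k) w)
  rearrange : ∀ a b c → a + b + c ≡ a + c + b
  rearrange = solve-∀
  rearrange′ : ∀ a x y l → a + x * l + y * l ≡ a + (x + y) * l
  rearrange′ = solve-∀

descents-≤ : ∀ a w → descents a w ≤ length w
descents-≤ a []      = z≤n
descents-≤ a (b ∷ w) = +-mono-≤ (descent≤1 a b) (descents-≤ b w)

-- If all `suc (length w)` comparisons on the way from `a` to `z` were descents, then `z < a`; so at
-- least one is not.
descents-∷ʳ-≤ : ∀ {a z} w → a ≤ z → descents a (w ∷ʳ z) ≤ length w
descents-∷ʳ-≤ {a} {z} [] a≤z rewrite descent-≤ a≤z = z≤n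
descents-∷ʳ-≤ {a} {z} (b ∷ w) a≤z with b <? a
... | yes b<a rewrite descent-> b<a = s≤s (descents-∷ʳ-≤ w (≤-trans (<⇒≤ b<a) a≤z))
... | no  b≮a rewrite descent-≤ (≮⇒≥ b≮a) = ≤-trans (descents-≤ b (w ∷ʳ z)) (≤-reflexive (trans (length-++ w) (+-comm (length w) 1)))

cyclicDescents-< : ∀ w → 0 < length w → cyclicDescents w < length w
cyclicDescents-< (a ∷ w) _ = s≤s (descents-∷ʳ-≤ w ≤-refl)

descent≡0⇒≤ : ∀ {a b} → descent a b ≡ 0 → a ≤ b
descent≡0⇒≤ {a} {b} eq = ≮⇒≥ λ b<a → 1+n≢0 (trans (sym (descent-> b<a)) eq)

descents≡0⇒between : ∀ {a z} w → descents a (w ∷ʳ z) ≡ 0 → a ≤ z × (∀ {b} → b ∈ w → a ≤ b × b ≤ z)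
descents≡0⇒between {a} {z} [] eq = descent≡0⇒≤ (m+n≡0⇒m≡0 (descent a z) eq) , λ ()
descents≡0⇒between {a} {z} (b ∷ w) eq
  with a≤b ← descent≡0⇒≤ (m+n≡0⇒m≡0 (descent a b) eq)
     | b≤z , between ← descents≡0⇒between w (m+n≡0⇒n≡0 (descent a b) eq)
  = ≤-trans a≤b b≤z ,
    λ { (here refl) → a≤b , b≤z
      ; (there c∈w) → ≤-trans a≤b (proj₁ (between c∈w)) , proj₂ (between c∈w) }

-- Without cyclic descents the word rises weakly from `a` back to `a`, which squeezes every letter
-- to `a`.
cyclicDescents≡0⇒constant : ∀ w → cyclicDescents w ≡ 0 → ∀ {b c} → b ∈ w → c ∈ w → b ≡ c
cyclicDescents≡0⇒constant (a ∷ w) eq b∈ c∈ = trans (≡a b∈) (sym (≡a c∈))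
  where
  ≡a : ∀ {b} → b ∈ a ∷ w → b ≡ a
  ≡a (here refl) = refl
  ≡a (there b∈w) with a≤b , b≤a ← proj₂ (descents≡0⇒between w eq) b∈w = ≤-antisym b≤a a≤b

major-constant : ∀ w → (∀ {b c} → b ∈ w → c ∈ w → b ≡ c) → major w ≡ 0
major-constant []      _     = refl
major-constant (a ∷ w) const = go 1 a w const
  where
  go : ∀ i a w → (∀ {b c} → b ∈ a ∷ w → c ∈ a ∷ w → b ≡ c) → majorFrom i a w ≡ 0
  go i a []      _     = refl
  go i a (b ∷ w) const
    rewrite descent-≤ (≤-reflexive (const (here refl) (there (here refl))))
          | *-zeroʳ i = go (suc i) b w (λ x∈ y∈ → const (there x∈) (there y∈))

-- Rotations of a nonconstant word of prime length

module _ {p : ℕ} (p-prime : Prime p) (w : List ℕ) (∣w∣≡p : length w ≡ p)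
         (w-nonconstant : cyclicDescents w ≢ 0) where

  private
    instance
      p≢0 : NonZero p
      p≢0 = prime⇒nonZero p-prime

    0<∣w∣ : 0 < length w
    0<∣w∣ = subst (0 <_) (sym ∣w∣≡p) (>-nonZero⁻¹ p)

    ∤ : ∀ {m} → m ≢ 0 → m < p → ¬ p ∣ m
    ∤ m≢0 m<p p∣m = <⇒≱ m<p (∣⇒≤ {{≢-nonZero m≢0}} p∣m)

  -- Equal residues would make `p` divide `(k′ ∸ k) * d`, with `d` the number of cyclic descents.
  -- Both factors lie strictly between 0 and `p`, contradicting Euclid's lemma.
  major-rotate-distinct : ∀ {k k′} → k < k′ → k′ < p →
    suc (major (rotate k w)) % p ≢ suc (major (rotate k′ w)) % p
  major-rotate-distinct {k} {k′} k<k′ k′<p eq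
    with x , shift ← major-rotate (k′ ∸ k) k w
    rewrite m∸n+n≡m (<⇒≤ k<k′) | ∣w∣≡p
    = [ ∤ (m>n⇒m∸n≢0 k<k′) (≤-<-trans (m∸n≤m k′ k) k′<p)
      , ∤ w-nonconstant (subst (cyclicDescents w <_) ∣w∣≡p (cyclicDescents-< w 0<∣w∣))
      ]′ (euclidsLemma j d p-prime p∣jd)
    where
    j = k′ ∸ k
    d = cyclicDescents w
    a = suc (major (rotate k w))
    a′ = suc (major (rotate k′ w))
    open ≡-Reasoning
    rearrange : ∀ r q jd → r + (q + jd) ≡ r + q + jd
    rearrange = solve-∀
    -- The equal remainders cancel from `shift`, which leaves `j * d` among multiples of `p`.
    cancelled : a′ / p * p + j * d ≡ a / p * p + x * p
    cancelled = +-cancelˡ-≡ (a′ % p) _ _ (begin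
      a′ % p + (a′ / p * p + j * d) ≡⟨ rearrange (a′ % p) _ _ ⟩
      a′ % p + a′ / p * p + j * d   ≡⟨ cong (_+ j * d) (m≡m%n+[m/n]*n a′ p) ⟨
      a′ + j * d                    ≡⟨ cong suc shift ⟩
      a + x * p                     ≡⟨ cong (_+ x * p) (m≡m%n+[m/n]*n a p) ⟩
      a % p + a / p * p + x * p     ≡⟨ cong (λ r → r + a / p * p + x * p) eq ⟩
      a′ % p + a / p * p + x * p    ≡⟨ rearrange (a′ % p) _ _ ⟨
      a′ % p + (a / p * p + x * p)  ∎)
    p∣jd : p ∣ j * d
    p∣jd = ∣m+n∣m⇒∣n (subst (p ∣_) (sym cancelled) (∣m∣n⇒∣m+n (n∣m*n (a / p)) (n∣m*n x)))
                    (n∣m*n (a′ / p))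

  rotation-unique : ∀ {k k′} → k < p → k′ < p →
    p ∣ suc (major (rotate k w)) → p ∣ suc (major (rotate k′ w)) → k ≡ k′
  rotation-unique {k} {k′} k<p k′<p p∣ p∣′ with <-cmp k k′
  ... | tri≈ _ k≡k′ _ = k≡k′
  ... | tri< k<k′ _ _ = contradiction
    (trans (n∣m⇒m%n≡0 _ p p∣) (sym (n∣m⇒m%n≡0 _ p p∣′))) (major-rotate-distinct k<k′ k′<p)
  ... | tri> _ _ k′<k = contradiction
    (trans (n∣m⇒m%n≡0 _ p p∣′) (sym (n∣m⇒m%n≡0 _ p p∣))) (major-rotate-distinct k′<k k<p)

  private
    residue : Fin p → Fin p
    residue i = suc (major (rotate (toℕ i) w)) mod p

    residue-toℕ : ∀ i → toℕ (residue i) ≡ suc (major (rotate (toℕ i) w)) % p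
    residue-toℕ i = Finₚ.toℕ-fromℕ< _

    residue-≡ : ∀ i j → residue i ≡ residue j →
      suc (major (rotate (toℕ i) w)) % p ≡ suc (major (rotate (toℕ j) w)) % p
    residue-≡ i j eq = trans (sym (residue-toℕ i)) (trans (cong toℕ eq) (residue-toℕ j))

    residue-injective : Injective _≡_ _≡_ residue
    residue-injective {i} {j} eq with <-cmp (toℕ i) (toℕ j)
    ... | tri≈ _ i≡j _ = Finₚ.toℕ-injective i≡j
    ... | tri< i<j _ _ = contradiction (residue-≡ i j eq) (major-rotate-distinct i<j (Finₚ.toℕ<n j))
    ... | tri> _ _ j<i = contradiction (residue-≡ j i (sym eq)) (major-rotate-distinct j<i (Finₚ.toℕ<n i))

  -- The `p` rotations have pairwise distinct residues, so `residue` is onto `Fin p` and takes the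
  -- value 0.
  rotation-exists : ∃ λ k → k < p × p ∣ suc (major (rotate k w))
  rotation-exists
    with i , eq ← injective⇒surjective residue residue-injective (fromℕ< (>-nonZero⁻¹ p))
    = toℕ i , Finₚ.toℕ<n i ,
      m%n≡0⇒n∣m _ p (trans (sym (residue-toℕ i)) (trans (cong toℕ eq) (Finₚ.toℕ-fromℕ< _)))

-- Lexicographic rankings

bounded : ∀ {n} (r : Fin n → ℕ) → ∃ λ N → ∀ v → r v < N
bounded {zero}  r = 0 , λ ()
bounded {suc n} r with N , r<N ← bounded (r ∘ suc) =
  suc (r zero) ⊔ N , λ
    { zero    → m≤m⊔n (suc (r zero)) N
    ; (suc v) → ≤-trans (r<N v) (m≤n⊔m (suc (r zero)) N) }

module _ {n} (g r : Fin n → ℕ) where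

  -- The pair of `g v` and `r v` as one number in base `N`, where `N` exceeds all values of `r`:
  -- `r v` is the last digit and `g v` is what precedes it.
  lexicographic : Fin n → ℕ
  lexicographic v = r v + g v * proj₁ (bounded r)

  lexicographic-<ˡ : ∀ {u v} → g u < g v → lexicographic u < lexicographic v
  lexicographic-<ˡ {u} {v} gu<gv with N , r<N ← bounded r = begin-strict
    r u + g u * N <⟨ +-monoˡ-< (g u * N) (r<N u) ⟩
    suc (g u) * N ≤⟨ *-monoˡ-≤ N gu<gv ⟩
    g v * N       ≤⟨ m≤n+m (g v * N) (r v) ⟩
    r v + g v * N ∎
    where open ≤-Reasoning

  lexicographic-<ʳ : ∀ {u v} → g u ≡ g v → r u < r v → lexicographic u < lexicographic v
  lexicographic-<ʳ {u} {v} gu≡gv ru<rv rewrite gu≡gv = +-monoˡ-< (g v * proj₁ (bounded r)) ru<rv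

  lexicographic-injective : Injective _≡_ _≡_ r → Injective _≡_ _≡_ lexicographic
  lexicographic-injective r-inj {u} {v} eq with <-cmp (g u) (g v)
  ... | tri< gu<gv _ _ = contradiction eq (<⇒≢ (lexicographic-<ˡ gu<gv))
  ... | tri> _ _ gv<gu = contradiction (sym eq) (<⇒≢ (lexicographic-<ˡ gv<gu))
  ... | tri≈ _ gu≡gv _ rewrite gu≡gv = r-inj (+-cancelʳ-≡ (g v * proj₁ (bounded r)) (r u) (r v) eq)

AllPairs-map-∈ : {A : Set} {R S : A → A → Set} {xs : List A} →
  (∀ {x y} → x ∈ xs → y ∈ xs → R x y → S x y) → AllPairs R xs → AllPairs S xs
AllPairs-map-∈ f []         = []
AllPairs-map-∈ f (rs ∷ rss) =
  All.tabulate (λ y∈ → f (here refl) (there y∈) (All.lookup rs y∈)) ∷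
  AllPairs-map-∈ (λ x∈ y∈ → f (there x∈) (there y∈)) rss

-- Acyclic hypergraphs

module _ {n} (H : Hypergraph n) where

  module _ (Q : Fin (edgeCount H) → Set) where

    -- A walk with `m` edges, all satisfying `Q`. An edge outside `Q` is then automatically
    -- different from every edge of the trail, which is what `close` relies on.
    data Trail : Fin n → Fin n → ℕ → Set where
      []   : ∀ {v} → Trail v v 0
      step : ∀ {u w v m} e → u ∈ₛ edge H e → w ∈ₛ edge H e → Q e → Trail w v m → Trail u v (suc m)

  module _ {Q : Fin (edgeCount H) → Set} where

    vertexAt : ∀ {u v m} → Trail Q u v m → Fin (suc m) → Fin n
    vertexAt {u} t                  zero    = u
    vertexAt     (step _ _ _ _ t) (suc i) = vertexAt t i

    edgeAt : ∀ {u v m} → Trail Q u v m → Fin m → Fin (edgeCount H)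
    edgeAt (step e _ _ _ t) zero    = e
    edgeAt (step e _ _ _ t) (suc i) = edgeAt t i

    Simple : ∀ {u v m} → Trail Q u v m → Set
    Simple []                     = ⊤
    Simple {u} (step e _ _ _ t) =
      (∀ i → vertexAt t i ≢ u) × (∀ i → edgeAt t i ≢ e) × Simple t

    SimpleTrail : Fin n → Fin n → Set
    SimpleTrail u v = ∃ λ m → Σ (Trail Q u v m) Simple

    dropToVertex : ∀ {u v m} (t : Trail Q u v m) → Simple t → ∀ i → SimpleTrail (vertexAt t i) v
    dropToVertex t                s           zero    = _ , t , s
    dropToVertex (step _ _ _ _ t) (_ , _ , s) (suc i) = dropToVertex t s i

    -- The suffix that starts just after the `i`-th edge. Its first vertex still lies on that edge,
    -- the edge does not recur, and any vertex off `t` remains off the suffix; `prepend` uses all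
    -- three facts.
    dropThroughEdge : ∀ {u v m} (t : Trail Q u v m) → Simple t → ∀ i →
      ∃ λ w → w ∈ₛ edge H (edgeAt t i) × Σ (SimpleTrail w v) λ (_ , t′ , _) →
        (∀ j → edgeAt t′ j ≢ edgeAt t i) × (∀ j → ∃ λ j′ → vertexAt t′ j ≡ vertexAt t j′)
    dropThroughEdge (step e _ w∈e _ t) (_ , e∉t , s) zero =
      _ , w∈e , (_ , t , s) , e∉t , λ j → suc j , refl
    dropThroughEdge (step _ _ _ _ t) (_ , _ , s) (suc i)
      with w , w∈ , t′ , edges , vertices ← dropThroughEdge t s i =
      w , w∈ , t′ , edges , λ j → suc (proj₁ (vertices j)) , proj₂ (vertices j)

    -- If `u` is already on the trail, the part before it is dropped. If instead `e` is already
    -- used, the trail is cut just after `e`, and one step along `e` leads from `u` to the cut.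
    -- Otherwise the step is simply added.
    prepend : ∀ {u w v} e → u ∈ₛ edge H e → w ∈ₛ edge H e → Q e → SimpleTrail w v → SimpleTrail u v
    prepend {u} e u∈e w∈e q (_ , t , s) with Finₚ.any? (λ i → vertexAt t i Finₚ.≟ u)
    ... | yes (i , refl) = dropToVertex t s i
    ... | no  u∉t with Finₚ.any? (λ i → edgeAt t i Finₚ.≟ e)
    ...   | no  e∉t = _ , step e u∈e w∈e q t , (λ i eq → u∉t (i , eq)) , (λ i eq → e∉t (i , eq)) , s
    ...   | yes (i , refl)
      with x , x∈e , (_ , t′ , s′) , edges , vertices ← dropThroughEdge t s i
      = _ , step e u∈e x∈e q t′ ,
        (λ j eq → u∉t (proj₁ (vertices j) , trans (sym (proj₂ (vertices j))) eq)) , edges , s′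

    left-∈ : ∀ {u v m} (t : Trail Q u v m) i → vertexAt t (inject₁ i) ∈ₛ edge H (edgeAt t i)
    left-∈ (step _ u∈e _ _ t) zero    = u∈e
    left-∈ (step _ _   _ _ t) (suc i) = left-∈ t i

    right-∈ : ∀ {u v m} (t : Trail Q u v m) i → vertexAt t (suc i) ∈ₛ edge H (edgeAt t i)
    right-∈ (step _ _ w∈e _ t) zero    = w∈e
    right-∈ (step _ _ _   _ t) (suc i) = right-∈ t i

    edgeAt-Q : ∀ {u v m} (t : Trail Q u v m) i → Q (edgeAt t i)
    edgeAt-Q (step _ _ _ q t) zero    = q
    edgeAt-Q (step _ _ _ _ t) (suc i) = edgeAt-Q t i

    vertexAt-last : ∀ {u v m} (t : Trail Q u v m) → vertexAt t (fromℕ m) ≡ v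
    vertexAt-last []               = refl
    vertexAt-last (step _ _ _ _ t) = vertexAt-last t

    vertexAt-injective : ∀ {u v m} (t : Trail Q u v m) → Simple t → Injective _≡_ _≡_ (vertexAt t)
    vertexAt-injective t                _           {zero}  {zero}  _  = refl
    vertexAt-injective (step _ _ _ _ t) (u∉ , _)    {zero}  {suc j} eq = contradiction (sym eq) (u∉ j)
    vertexAt-injective (step _ _ _ _ t) (u∉ , _)    {suc i} {zero}  eq = contradiction eq (u∉ i)
    vertexAt-injective (step _ _ _ _ t) (_ , _ , s) {suc i} {suc j} eq =
      cong suc (vertexAt-injective t s eq)

    edgeAt-injective : ∀ {u v m} (t : Trail Q u v m) → Simple t → Injective _≡_ _≡_ (edgeAt t)
    edgeAt-injective (step _ _ _ _ t) _            {zero}  {zero}  _  = refl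
    edgeAt-injective (step _ _ _ _ t) (_ , e∉ , _) {zero}  {suc j} eq = contradiction (sym eq) (e∉ j)
    edgeAt-injective (step _ _ _ _ t) (_ , e∉ , _) {suc i} {zero}  eq = contradiction eq (e∉ i)
    edgeAt-injective (step _ _ _ _ t) (_ , _ , s)  {suc i} {suc j} eq =
      cong suc (edgeAt-injective t s eq)

    -- The closed path goes from `v` along `e` to `u` and returns to `v` along `t`. The edge `e` is
    -- new because the edges of `t` satisfy `Q`.
    close : ∀ {u v m} (t : Trail Q u v m) → Simple t → ∀ e → ¬ Q e →
      u ∈ₛ edge H e → v ∈ₛ edge H e → Path H (suc m)
    close {u} {v} {m} t s e ¬q u∈e v∈e = record
      { vertex            = vertex′
      ; pathEdge          = edge′
      ; left∈             = λ { zero → v∈e ; (suc i) → left-∈ t i }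
      ; right∈            = λ { zero → u∈e ; (suc i) → right-∈ t i }
      ; edges-distinct    = distinct
      ; vertices-distinct = λ
        -- The added initial vertex is `v`, which the simple trail visits only at its end.
        { zero    (suc j) _         eq →
            refl , cong suc (vertexAt-injective t s (trans (sym eq) (sym (vertexAt-last t))))
        ; (suc i) (suc j) (s≤s i<j) eq →
            contradiction (cong toℕ (vertexAt-injective t s eq)) (<⇒≢ i<j) }
      }
      where
      vertex′ : Fin (suc (suc m)) → Fin n
      vertex′ zero    = v
      vertex′ (suc i) = vertexAt t i
      edge′ : Fin (suc m) → Fin (edgeCount H)
      edge′ zero    = e
      edge′ (suc i) = edgeAt t i
      distinct : Injective _≡_ _≡_ edge′
      distinct {zero}  {zero}  _    = refl
      distinct {zero}  {suc j} refl = contradiction (edgeAt-Q t j) ¬q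
      distinct {suc i} {zero}  refl = contradiction (edgeAt-Q t i) ¬q
      distinct {suc i} {suc j} eq   = cong suc (edgeAt-injective t s eq)

  -- Components formed by the first `k` edges

  Adjacent : ℕ → Fin n → Fin n → Set
  Adjacent k u v = ∃ λ e → toℕ e < k × u ∈ₛ edge H e × v ∈ₛ edge H e

  Joined : ℕ → Fin n → Fin n → Set
  Joined k = Star (Adjacent k)

  Joined-sym : ∀ {k u v} → Joined k u v → Joined k v u
  Joined-sym = reverse λ (e , e<k , u∈e , v∈e) → e , e<k , v∈e , u∈e

  simpleTrail : ∀ {k u v} → Joined k u v → SimpleTrail {λ e → toℕ e < k} u v
  simpleTrail ε                              = 0 , [] , tt
  simpleTrail ((e , e<k , u∈e , w∈e) ◅ walk) = prepend e u∈e w∈e e<k (simpleTrail walk)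

  -- A walk along edges of smaller index shortens to a simple trail, which `e` closes to a cycle. As
  -- `u ≢ v`, the trail has at least one edge, so the cycle has at least two.
  acyclic⇒separated : Acyclic H → ∀ e {u v} → u ∈ₛ edge H e → v ∈ₛ edge H e → u ≢ v →
    ¬ Joined (toℕ e) u v
  acyclic⇒separated H-acyclic e u∈e v∈e u≢v walk with simpleTrail walk
  ... | zero  , [] , _ = u≢v refl
  ... | suc m , t  , s = H-acyclic _ (close t s e (<-irrefl refl) u∈e v∈e)
    (s≤s (s≤s z≤n) , sym (vertexAt-last t))

  Joined-weaken : ∀ {k u v} → Joined k u v → Joined (suc k) u v
  Joined-weaken ε = ε
  Joined-weaken ((e , e<k , u∈e , w∈e) ◅ walk) = (e , m<n⇒m<1+n e<k , u∈e , w∈e) ◅ Joined-weaken walk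

  module _ {k} (k<∣E∣ : k < edgeCount H) where

    private
      eₖ : Fin (edgeCount H)
      eₖ = fromℕ< k<∣E∣

    Through : Fin n → Fin n → Set
    Through u v = ∃₂ λ x y → (x ∈ₛ edge H eₖ × Joined k u x) × (y ∈ₛ edge H eₖ × Joined k y v)

    earlier-or-last : ∀ e → toℕ e < suc k → toℕ e < k ⊎ e ≡ eₖ
    earlier-or-last e (s≤s e≤k) with m≤n⇒m<n∨m≡n e≤k
    ... | inj₁ e<k  = inj₁ e<k
    ... | inj₂ refl = inj₂ (Finₚ.toℕ-injective (sym (Finₚ.toℕ-fromℕ< k<∣E∣)))

    -- Only the first entry into `eₖ` and the last exit from it matter: everything between them can
    -- be replaced by a single use of `eₖ`.
    Joined-split : ∀ {u v} → Joined (suc k) u v → Joined k u v ⊎ Through u v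
    Joined-split ε = inj₁ ε
    Joined-split ((e , e≤k , u∈e , w∈e) ◅ walk) with earlier-or-last e e≤k | Joined-split walk
    ... | inj₁ e<k  | inj₁ walk′ = inj₁ ((e , e<k , u∈e , w∈e) ◅ walk′)
    ... | inj₁ e<k  | inj₂ (x , y , (x∈ , p) , q) =
      inj₂ (x , y , (x∈ , (e , e<k , u∈e , w∈e) ◅ p) , q)
    ... | inj₂ refl | inj₁ walk′ = inj₂ (_ , _ , (u∈e , ε) , (w∈e , walk′))
    ... | inj₂ refl | inj₂ (_ , y , _ , q) = inj₂ (_ , y , (u∈e , ε) , q)

    Joined-join : ∀ {u v} → Joined k u v ⊎ Through u v → Joined (suc k) u v
    Joined-join (inj₁ walk) = Joined-weaken walk
    Joined-join (inj₂ (x , y , (x∈ , p) , (y∈ , q))) =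
      Joined-weaken p ◅◅ (eₖ , s≤s (≤-reflexive (Finₚ.toℕ-fromℕ< k<∣E∣)) , x∈ , y∈) ◅ Joined-weaken q

  -- A walk may be arbitrarily long, so the search recurses on the number of edges: for a new edge
  -- it suffices to try all entry vertices `x` and exit vertices `y`.
  joined? : ∀ {k} → k ≤ edgeCount H → Binary.Decidable (Joined k)
  joined? {zero}  _ u v with u Finₚ.≟ v
  ... | yes refl = yes ε
  ... | no  u≢v  = no λ { ε → u≢v refl ; ((_ , () , _) ◅ _) }
  joined? {suc k} k<∣E∣ u v = map′ (Joined-join k<∣E∣) (Joined-split k<∣E∣)
    (joined′? u v ⊎-dec
     Finₚ.any? λ x → Finₚ.any? λ y →
       ((x ∈ₛ? _) ×-dec joined′? u x) ×-dec ((y ∈ₛ? _) ×-dec joined′? y v))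
    where
    joined′? : Binary.Decidable (Joined k)
    joined′? = joined? (<⇒≤ k<∣E∣)

  -- The components of the first k edges are ranked by the vertex of the list
  -- they contain; components meeting no vertex of the list come last.
  module _ {k} (k≤∣E∣ : k ≤ edgeCount H) where

    componentRank : List (Fin n) → Fin n → ℕ
    componentRank []       v = 0
    componentRank (x ∷ xs) v = if does (joined? k≤∣E∣ x v) then 0 else suc (componentRank xs v)

    componentRank-cong : ∀ xs {u v} → Joined k u v → componentRank xs u ≡ componentRank xs v
    componentRank-cong []       walk = refl
    componentRank-cong (x ∷ xs) {u} {v} walk with joined? k≤∣E∣ x u | joined? k≤∣E∣ x v
    ... | yes _ | yes _ = refl
    ... | no  _ | no  _ = cong suc (componentRank-cong xs walk)
    ... | yes p | no ¬q = contradiction (p ◅◅ walk) ¬q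
    ... | no ¬p | yes q = contradiction (q ◅◅ Joined-sym walk) ¬p

    -- No vertex of the list is joined to an earlier one, so the rank of each is its own position.
    componentRank-increasing : ∀ {xs} → AllPairs (λ u v → ¬ Joined k u v) xs →
      AllPairs (λ u v → componentRank xs u < componentRank xs v) xs
    componentRank-increasing [] = []
    componentRank-increasing {x ∷ xs} (¬x ∷ ¬xs) =
      All.map first ¬x ∷
      AllPairs-map-∈ (λ u∈ v∈ → later (All.lookup ¬x u∈) (All.lookup ¬x v∈))
                     (componentRank-increasing ¬xs)
      where
      first : ∀ {v} → ¬ Joined k x v → componentRank (x ∷ xs) x < componentRank (x ∷ xs) v
      first {v} ¬xv rewrite dec-true (joined? k≤∣E∣ x x) ε | dec-false (joined? k≤∣E∣ x v) ¬xv = z<s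
      later : ∀ {u v} → ¬ Joined k x u → ¬ Joined k x v →
        componentRank xs u < componentRank xs v →
        componentRank (x ∷ xs) u < componentRank (x ∷ xs) v
      later {u} {v} ¬xu ¬xv lt
        rewrite dec-false (joined? k≤∣E∣ x u) ¬xu | dec-false (joined? k≤∣E∣ x v) ¬xv = s<s lt

  -- Extending linear orders of the edges to all vertices

  module _ (H-acyclic : Acyclic H) (order : Fin (edgeCount H) → List (Fin n))
           (order⊆edge : ∀ e {v} → v ∈ order e → v ∈ₛ edge H e)
           (order-unique : ∀ e → Unique (order e)) where

    private
      Extension : ℕ → Set
      Extension k = Σ (Fin n → ℕ) λ r → Injective _≡_ _≡_ r ×
        (∀ e → toℕ e < k → AllPairs (λ u v → r u < r v) (order e))

      -- The vertices of `eₖ` lie in different components of the earlier edges. Rearranging whole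
      -- components therefore puts `eₖ` in the desired order. An earlier edge lies inside one
      -- component, where `r` still decides, so its order survives.
      extension : ∀ k → k ≤ edgeCount H → Extension k
      extension zero    _     = toℕ , Finₚ.toℕ-injective , λ _ ()
      extension (suc k) k<∣E∣ with r , r-inj , r-inc ← extension k (<⇒≤ k<∣E∣) =
        lexicographic g r , lexicographic-injective g r r-inj , increasing
        where
        eₖ = fromℕ< k<∣E∣
        g = componentRank (<⇒≤ k<∣E∣) (order eₖ)
        separated : ∀ {u v} → u ∈ order eₖ → v ∈ order eₖ → u ≢ v → ¬ Joined k u v
        separated {u} {v} u∈ v∈ u≢v walk =
          acyclic⇒separated H-acyclic eₖ (order⊆edge eₖ u∈) (order⊆edge eₖ v∈) u≢v
            (subst (λ j → Joined j u v) (sym (Finₚ.toℕ-fromℕ< k<∣E∣)) walk)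
        increasing : ∀ e → toℕ e < suc k →
          AllPairs (λ u v → lexicographic g r u < lexicographic g r v) (order e)
        increasing e e≤k with earlier-or-last k<∣E∣ e e≤k
        ... | inj₁ e<k = AllPairs-map-∈
          (λ u∈ v∈ → lexicographic-<ʳ g r (componentRank-cong (<⇒≤ k<∣E∣) (order eₖ)
            ((e , e<k , order⊆edge e u∈ , order⊆edge e v∈) ◅ ε)))
          (r-inc e e<k)
        ... | inj₂ refl = AllPairs.map (lexicographic-<ˡ g r)
          (componentRank-increasing (<⇒≤ k<∣E∣) (AllPairs-map-∈ separated (order-unique eₖ)))

    orders-extend : Σ (Fin n → ℕ) λ r → Injective _≡_ _≡_ r ×
      (∀ e → AllPairs (λ u v → r u < r v) (order e))
    orders-extend with r , r-inj , r-inc ← extension (edgeCount H) ≤-refl =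
      r , r-inj , λ e → r-inc e (Finₚ.toℕ<n e)

-- Sorting and standardization

module _ {n} {P : Fin n → Set} (P? : ∀ i → Dec (P i)) where

  private
    ⟦P⟧ : Subset n
    ⟦P⟧ = tabulate (does ∘ P?)

  ∈-tabulate-does⁺ : ∀ {i} → P i → i ∈ₛ ⟦P⟧
  ∈-tabulate-does⁺ {i} p = lookup⇒[]= i _ (trans (lookup∘tabulate _ i) (dec-true (P? i) p))

  ∈-tabulate-does⁻ : ∀ {i} → i ∈ₛ ⟦P⟧ → P i
  ∈-tabulate-does⁻ {i} i∈ with P? i | trans (sym (lookup∘tabulate (does ∘ P?) i)) ([]=⇒lookup i∈)
  ... | yes p | _ = p
  ... | no  _ | ()

module _ {n} (f : Fin n → ℕ) where

  private
    below : Fin n → Subset n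
    below v = tabulate λ u → does (f u <? f v)

    ∈-below⁺ : ∀ {u v} → f u < f v → u ∈ₛ below v
    ∈-below⁺ {v = v} = ∈-tabulate-does⁺ (λ u → f u <? f v)

    ∈-below⁻ : ∀ {u v} → u ∈ₛ below v → f u < f v
    ∈-below⁻ {v = v} = ∈-tabulate-does⁻ (λ u → f u <? f v)

    below<n : ∀ v → ∣ below v ∣ < n
    below<n v = subst (∣ below v ∣ <_) (∣⊤∣≡n n)
      (p⊂q⇒∣p∣<∣q∣ ((λ _ → ∈⊤) , v , ∈⊤ , λ v∈ → <-irrefl refl (∈-below⁻ v∈)))

  -- The number of `u` with `f u < f v`; for injective `f` this is the position of `v` when the
  -- values are sorted.
  rank : Fin n → Fin n
  rank v = fromℕ< (below<n v)

  rank-mono-< : ∀ {u v} → f u < f v → rank u Fin.< rank v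
  rank-mono-< {u} {v} fu<fv
    rewrite Finₚ.toℕ-fromℕ< (below<n u) | Finₚ.toℕ-fromℕ< (below<n v) =
    p⊂q⇒∣p∣<∣q∣ ((λ x∈ → ∈-below⁺ (<-trans (∈-below⁻ x∈) fu<fv)) ,
                 u , ∈-below⁺ fu<fv , λ u∈ → <-irrefl refl (∈-below⁻ u∈))

  rank-injective : Injective _≡_ _≡_ f → Injective _≡_ _≡_ rank
  rank-injective f-inj {u} {v} eq with <-cmp (f u) (f v)
  ... | tri≈ _ fu≡fv _ = f-inj fu≡fv
  ... | tri< fu<fv _ _ = contradiction (cong toℕ eq) (<⇒≢ (rank-mono-< fu<fv))
  ... | tri> _ _ fv<fu = contradiction (cong toℕ (sym eq)) (<⇒≢ (rank-mono-< fv<fu))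

Increasing : ∀ {n} → (Fin n → ℕ) → Set
Increasing f = ∀ {i j} → i Fin.< j → f i < f j

adjacent⇒increasing : ∀ {n} (f : Fin (suc n) → ℕ) → (∀ j → f (inject₁ j) < f (suc j)) → Increasing f
adjacent⇒increasing {suc n} f adj {zero}  {suc zero}    _ = adj zero
adjacent⇒increasing {suc n} f adj {zero}  {suc (suc j)} _ =
  <-trans (adj zero) (adjacent⇒increasing (f ∘ suc) (adj ∘ suc) {zero} {suc j} z<s)
adjacent⇒increasing {suc n} f adj {suc i} {suc j} (s≤s i<j) =
  adjacent⇒increasing (f ∘ suc) (adj ∘ suc) i<j

-- The offset `c` serves the induction; with `c = 0` the values of `f` dominate the identity.
increasing⇒≥ : ∀ {n} (f : Fin n → ℕ) → Increasing f → ∀ c → (∀ i → c ≤ f i) → ∀ i → c + toℕ i ≤ f i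
increasing⇒≥ f inc c c≤f zero    = ≤-trans (≤-reflexive (+-identityʳ c)) (c≤f zero)
increasing⇒≥ f inc c c≤f (suc i) = ≤-trans (≤-reflexive (+-suc c (toℕ i)))
  (increasing⇒≥ (f ∘ suc) (λ i<j → inc (s≤s i<j)) (suc c) (λ j → ≤-<-trans (c≤f zero) (inc z<s)) i)

Inverses : ∀ {n} → (Fin n → Fin n) → (Fin n → Fin n) → Set
Inverses ρ σ = (∀ v → σ (ρ v) ≡ v) × (∀ i → ρ (σ i) ≡ i)

module _ {n} {f : Fin n → ℕ} where

  increasing⇒reflects : ∀ {ρ σ} → Inverses ρ σ → Increasing (f ∘ σ) →
    ∀ {u v} → f u < f v → ρ u Fin.< ρ v
  increasing⇒reflects {ρ} {σ} (σρ , ρσ) inc {u} {v} fu<fv with Finₚ.<-cmp (ρ u) (ρ v)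
  ... | tri< ρu<ρv _ _ = ρu<ρv
  ... | tri≈ _ ρu≡ρv _ = contradiction
    (cong f (trans (sym (σρ u)) (trans (cong σ ρu≡ρv) (σρ v)))) (<⇒≢ fu<fv)
  ... | tri> _ _ ρv<ρu = contradiction
    (subst₂ _<_ (cong f (σρ v)) (cong f (σρ u)) (inc ρv<ρu)) (<-asym fu<fv)

  -- The map `ρ′ ∘ σ` is a strictly increasing self-map of `Fin n`, hence at least the identity;
  -- this is evaluated at `ρ v`. By symmetry, sorting permutations are unique.
  increasing-≤ : ∀ {ρ σ ρ′ σ′} → Inverses ρ σ → Inverses ρ′ σ′ →
    Increasing (f ∘ σ) → Increasing (f ∘ σ′) → ∀ v → ρ v Fin.≤ ρ′ v
  increasing-≤ {ρ} {σ} {ρ′} inv inv′ inc inc′ v = subst (λ u → toℕ (ρ v) ≤ toℕ (ρ′ u)) (proj₁ inv v)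
    (increasing⇒≥ (λ i → toℕ (ρ′ (σ i))) (λ i<j → increasing⇒reflects inv′ inc′ (inc i<j)) 0 (λ _ → z≤n) (ρ v))

  increasing-unique : ∀ {ρ σ ρ′ σ′} → Inverses ρ σ → Inverses ρ′ σ′ →
    Increasing (f ∘ σ) → Increasing (f ∘ σ′) → (∀ v → ρ v ≡ ρ′ v) × (∀ i → σ i ≡ σ′ i)
  increasing-unique {ρ} {σ} {ρ′} {σ′} inv inv′ inc inc′ = ρ≗ρ′ , λ i →
    trans (sym (proj₁ inv′ (σ i))) (cong σ′ (trans (sym (ρ≗ρ′ (σ i))) (proj₂ inv i)))
    where
    ρ≗ρ′ : ∀ v → ρ v ≡ ρ′ v
    ρ≗ρ′ v = Finₚ.≤-antisym (increasing-≤ inv inv′ inc inc′ v) (increasing-≤ inv′ inv inc′ inc v)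

  sorting : Injective _≡_ _≡_ f → ∃₂ λ ρ σ → Inverses ρ σ × Increasing (f ∘ σ)
  sorting f-inj = rank f , σ , (σρ , ρσ) , λ {i} {j} i<j → inc i j i<j
    where
    σ : Fin n → Fin n
    σ i = proj₁ (injective⇒surjective (rank f) (rank-injective f f-inj) i)
    ρσ : ∀ i → rank f (σ i) ≡ i
    ρσ i = proj₂ (injective⇒surjective (rank f) (rank-injective f f-inj) i)
    σρ : ∀ v → σ (rank f v) ≡ v
    σρ v = rank-injective f f-inj (ρσ (rank f v))
    inc : ∀ i j → i Fin.< j → f (σ i) < f (σ j)
    inc i j i<j with <-cmp (f (σ i)) (f (σ j))
    ... | tri< lt _ _ = lt
    ... | tri≈ _ eq _ = contradiction (cong toℕ (trans (sym (ρσ i)) (trans (cong (rank f) (f-inj eq)) (ρσ j)))) (<⇒≢ i<j)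
    ... | tri> _ _ gt = contradiction (subst₂ Fin._<_ (ρσ j) (ρσ i) (rank-mono-< f gt)) (<-asym i<j)

-- Here `r` is the tie-breaking ranking read in sorted order. Where it falls, equal letters would
-- stand in the wrong order, so strict increase is demanded.
descentSet : ∀ {n} → (Fin n → ℕ) → Subset (n ∸ 1)
descentSet {zero}  r = []
descentSet {suc n} r = tabulate λ j → does (r (suc j) <? r (inject₁ j))

-- The two hypotheses on `f` say that it compares by the letters of `w` first and by `r` second.
-- Adjacent positions suffice: where `r` falls the letters rise strictly, and where `r` rises it
-- settles a tie correctly.
compatible⇒increasing : ∀ {n} {w : Vec ℕ n} {r f : Fin n → ℕ} → Injective _≡_ _≡_ r →
  (∀ {i j} → lookup w i < lookup w j → f i < f j) →
  (∀ {i j} → lookup w i ≡ lookup w j → r i < r j → f i < f j) →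
  Compatible (descentSet r) w → Increasing f
compatible⇒increasing {zero}  _ _ _ _ {()}
compatible⇒increasing {suc n} {w} {r} {f} r-inj f-<ˡ f-<ʳ compatible = adjacent⇒increasing f adj
  where
  adj : ∀ j → f (inject₁ j) < f (suc j)
  adj j with compatible j | <-cmp (r (inject₁ j)) (r (suc j))
  ... | _ , strict | tri> _ _ r> =
    f-<ˡ (strict (∈-tabulate-does⁺ (λ j → r (suc j) <? r (inject₁ j)) r>))
  ... | _ | tri≈ _ r≡ _ = contradiction (cong toℕ (r-inj r≡))
    (<⇒≢ (s≤s (≤-reflexive (Finₚ.toℕ-inject₁ j))))
  ... | weak , _ | tri< r< _ _ with m≤n⇒m<n∨m≡n weak
  ...   | inj₁ w< = f-<ˡ w<
  ...   | inj₂ w≡ = f-<ʳ w≡ r<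

-- A fall of the letters, or a tie at a fall of `r`, would make `f` fall.
increasing⇒compatible : ∀ {n} {w : Vec ℕ n} {r f : Fin n → ℕ} →
  (∀ {i j} → lookup w i < lookup w j → f i < f j) →
  (∀ {i j} → lookup w i ≡ lookup w j → r i < r j → f i < f j) →
  Increasing f → Compatible (descentSet r) w
increasing⇒compatible {zero}  _ _ _ = tt
increasing⇒compatible {suc n} {w} {r} {f} f-<ˡ f-<ʳ inc j = weak , λ j∈ → ≤∧≢⇒< weak λ w≡ →
  <-asym f< (f-<ʳ (sym w≡) (∈-tabulate-does⁻ (λ j → r (suc j) <? r (inject₁ j)) j∈))
  where
  f< : f (inject₁ j) < f (suc j)
  f< = inc (s≤s (≤-reflexive (Finₚ.toℕ-inject₁ j)))
  weak : lookup w (inject₁ j) ≤ lookup w (suc j)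
  weak = ≮⇒≥ λ w> → <-asym f< (f-<ˡ w>)

-- The major index sees only which consecutive entries descend. Since `vs` increases in `r`,
-- comparing in that direction is enough, and a tie of `g` may become a strict ascent of `h`, as it
-- does under standardization.
major-cong : ∀ {n} {r g h : Fin n → ℕ} (vs : List (Fin n)) → AllPairs (λ u v → r u < r v) vs →
  (∀ {u v} → r u < r v → (g v < g u → h v < h u) × (g u ≤ g v → h u ≤ h v)) →
  major (map g vs) ≡ major (map h vs)
major-cong [] _ _ = refl
major-cong {r = r} {g} {h} (v ∷ vs) ordered same = go 1 v vs ordered
  where
  descent-cong : ∀ {u v} → r u < r v → descent (g u) (g v) ≡ descent (h u) (h v)
  descent-cong {u} {v} ru<rv with g v <? g u
  ... | yes gv<gu = trans (descent-> gv<gu) (sym (descent-> (proj₁ (same ru<rv) gv<gu)))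
  ... | no  gv≮gu = trans (descent-≤ (≮⇒≥ gv≮gu)) (sym (descent-≤ (proj₂ (same ru<rv) (≮⇒≥ gv≮gu))))
  go : ∀ i v vs → AllPairs (λ u v → r u < r v) (v ∷ vs) →
    majorFrom i (g v) (map g vs) ≡ majorFrom i (h v) (map h vs)
  go i u []       _                       = refl
  go i u (v ∷ vs) ((ru<rv ∷ _) ∷ ordered) =
    cong₂ _+_ (cong (i *_) (descent-cong ru<rv)) (go (suc i) v vs ordered)

-- Counting words

unique∧set⇒↭ : {A : Set} {xs ys : List A} → Unique xs → Unique ys →
  (∀ {x} → x ∈ xs → x ∈ ys) → (∀ {x} → x ∈ ys → x ∈ xs) → xs ↭ ys
unique∧set⇒↭ xs! ys! xs⊆ys ys⊆xs = ∼bag⇒↭ (unique∧set⇒bag xs! ys! (mk⇔ xs⊆ys ys⊆xs))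

reindex : ∀ {A : Set} {n} → (Fin n → Fin n) → Vec A n → Vec A n
reindex σ w = tabulate (λ i → lookup w (σ i))

count-tabulate : ∀ {A : Set} {P : Pred A 0ℓ} (P? : Decidable P) {n} (g : Fin n → A) →
  count P? (tabulate g) ≡ length (filter P? (List.tabulate g))
count-tabulate P? {zero}  g = refl
count-tabulate P? {suc n} g with does (P? (g zero))
... | true  = cong suc (count-tabulate P? (g ∘ suc))
... | false = count-tabulate P? (g ∘ suc)

module _ {n} {ρ σ : Fin n → Fin n} (inv : Inverses ρ σ) where

  reindex-inverse : {A : Set} (w : Vec A n) → reindex ρ (reindex σ w) ≡ w
  reindex-inverse w = trans
    (tabulate-cong (λ v → trans (lookup∘tabulate _ (ρ v)) (cong (lookup w) (proj₁ inv v))))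
    (tabulate∘lookup w)

  -- The values of `σ` list every index exactly once, so the letters are merely permuted.
  multiplicity-reindex : ∀ w c → multiplicity (reindex σ w) c ≡ multiplicity w c
  multiplicity-reindex w c = begin
    count (c ≟_) (tabulate (lookup w ∘ σ))                   ≡⟨ count-tabulate (c ≟_) (lookup w ∘ σ) ⟩
    length (filter (c ≟_) (List.tabulate (lookup w ∘ σ)))     ≡⟨ cong (length ∘ filter (c ≟_)) (map-tabulate σ (lookup w)) ⟨
    length (filter (c ≟_) (map (lookup w) (List.tabulate σ))) ≡⟨ ↭-length (filter-↭ (c ≟_) (↭-map⁺ (lookup w) σ↭id)) ⟩
    length (filter (c ≟_) (map (lookup w) (allFin n)))        ≡⟨ cong (length ∘ filter (c ≟_)) (map-tabulate id (lookup w)) ⟩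
    length (filter (c ≟_) (List.tabulate (lookup w)))         ≡⟨ count-tabulate (c ≟_) (lookup w) ⟨
    count (c ≟_) (tabulate (lookup w))                        ≡⟨ cong (count (c ≟_)) (tabulate∘lookup w) ⟩
    count (c ≟_) w                                            ∎
    where
    open ≡-Reasoning
    σ↭id : List.tabulate σ ↭ allFin n
    σ↭id = unique∧set⇒↭
      (Uniqueₚ.tabulate⁺ (λ {i} {j} eq → trans (sym (proj₂ inv i)) (trans (cong ρ eq) (proj₂ inv j))))
      (Uniqueₚ.allFin⁺ n)
      (λ _ → ∈-allFin _)
      (λ {v} _ → subst (_∈ List.tabulate σ) (proj₁ inv v) (∈-tabulate⁺ (ρ v)))

module _ {n} {P Q : Pred (Vec ℕ n) 0ℓ} (P? : Decidable P) (Q? : Decidable Q) where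

  -- For each monomial, `reindex σ` is a bijection between the two lists of terms, with inverse
  -- `reindex ρ`.
  wordSeries-reindex : ∀ {ρ σ} → Inverses ρ σ →
    (∀ {w} → P w → Q (reindex σ w)) → (∀ {w} → Q (reindex σ w) → P w) →
    ∀ α → wordSeries P? α ≡ wordSeries Q? α
  wordSeries-reindex {ρ} {σ} inv P⇒Q Q⇒P α = cong +_ (begin
    length (terms P? α)                    ≡⟨ length-map (reindex σ) (terms P? α) ⟨
    length (map (reindex σ) (terms P? α))  ≡⟨ ↭-length (unique∧set⇒↭
                                                (Uniqueₚ.map⁺ reindex-injective (terms-unique P? α))
                                                (terms-unique Q? α) to from) ⟩
    length (terms Q? α)                    ∎)
    where
    open ≡-Reasoning
    inv′ : Inverses σ ρ
    inv′ = proj₂ inv , proj₁ inv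
    reindex-injective : ∀ {w w′ : Vec ℕ n} → reindex σ w ≡ reindex σ w′ → w ≡ w′
    reindex-injective {w} {w′} eq =
      trans (sym (reindex-inverse inv w)) (trans (cong (reindex ρ) eq) (reindex-inverse inv w′))
    to : ∀ {w} → w ∈ map (reindex σ) (terms P? α) → w ∈ terms Q? α
    to w∈ with w′ , w′∈ , refl ← ∈-map⁻ (reindex σ) w∈ with p , mult ← ∈-terms⁻ P? α w′∈ =
      ∈-terms⁺ Q? α (P⇒Q p) (λ c → trans (multiplicity-reindex inv w′ c) (mult c))
    from : ∀ {w} → w ∈ terms Q? α → w ∈ map (reindex σ) (terms P? α)
    from {w} w∈ with q , mult ← ∈-terms⁻ Q? α w∈ =
      subst (_∈ map (reindex σ) (terms P? α)) (reindex-inverse {ρ = σ} {ρ} inv′ w)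
        (∈-map⁺ (reindex σ) (∈-terms⁺ P? α {reindex ρ w}
          (Q⇒P (subst Q (sym (reindex-inverse {ρ = σ} {ρ} inv′ w)) q))
          (λ c → trans (multiplicity-reindex {ρ = σ} {ρ} inv′ w c) (mult c))))

-- Integer sums and counting by classes

module _ {A : Set} where

  sumℤ-zero : (g : A → ℤ) → (∀ x → g x ≡ 0ℤ) → ∀ xs → sumℤ (map g xs) ≡ 0ℤ
  sumℤ-zero g g≡0 []       = refl
  sumℤ-zero g g≡0 (x ∷ xs) rewrite g≡0 x = trans (ℤₚ.+-identityˡ _) (sumℤ-zero g g≡0 xs)

  sumℤ-single : (g : A → ℤ) → ∀ {x xs} → Unique xs → x ∈ xs → (∀ {y} → y ≢ x → g y ≡ 0ℤ) →
    sumℤ (map g xs) ≡ g x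
  sumℤ-single g {x} {_ ∷ xs} (x∉xs ∷ _) (here refl) g≡0 =
    trans (cong (λ s → g x ℤ.+ s) (rest xs (All.map (λ x≢y → g≡0 (x≢y ∘ sym)) x∉xs))) (ℤₚ.+-identityʳ (g x))
    where
    rest : ∀ ys → All (λ y → g y ≡ 0ℤ) ys → sumℤ (map g ys) ≡ 0ℤ
    rest []       []         = refl
    rest (y ∷ ys) (eq ∷ eqs) rewrite eq = trans (ℤₚ.+-identityˡ _) (rest ys eqs)
  sumℤ-single g {x} {y ∷ xs} (y∉xs ∷ xs!) (there x∈xs) g≡0 rewrite g≡0 (All.lookup y∉xs x∈xs) =
    trans (ℤₚ.+-identityˡ _) (sumℤ-single g xs! x∈xs g≡0)

  sumℤ-cong : {g h : A → ℤ} → (∀ x → g x ≡ h x) → ∀ xs → sumℤ (map g xs) ≡ sumℤ (map h xs)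
  sumℤ-cong g≗h []       = refl
  sumℤ-cong g≗h (x ∷ xs) = cong₂ ℤ._+_ (g≗h x) (sumℤ-cong g≗h xs)

  sumℤ-+ : (g h : A → ℤ) → ∀ xs →
    sumℤ (map (λ x → g x ℤ.+ h x) xs) ≡ sumℤ (map g xs) ℤ.+ sumℤ (map h xs)
  sumℤ-+ g h []       = refl
  sumℤ-+ g h (x ∷ xs) = trans (cong (λ s → g x ℤ.+ h x ℤ.+ s) (sumℤ-+ g h xs))
    (interchange ℤₚ.+-commutativeSemigroup (g x) (h x) (sumℤ (map g xs)) (sumℤ (map h xs)))

indicator : {P : Set} → Dec P → ℤ
indicator P? = if does P? then 1ℤ else 0ℤ

indicator-true : {P : Set} (P? : Dec P) → P → indicator P? ≡ 1ℤ
indicator-true P? p rewrite dec-true P? p = refl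

indicator-false : {P : Set} (P? : Dec P) → ¬ P → indicator P? ≡ 0ℤ
indicator-false P? ¬p rewrite dec-false P? ¬p = refl

length-filter-∷ : {A : Set} {P : Pred A 0ℓ} (P? : Decidable P) → ∀ x xs →
  + length (filter P? (x ∷ xs)) ≡ indicator (P? x) ℤ.+ + length (filter P? xs)
length-filter-∷ P? x xs with P? x
... | yes _ = refl
... | no  _ = sym (ℤₚ.+-identityˡ _)

module _ {A C : Set} {P : Pred A 0ℓ} (P? : Decidable P)
         {R : C → Pred A 0ℓ} (R? : ∀ c → Decidable (R c)) {L : List C} (L! : Unique L)
         (covered : ∀ {x} → P x → ∃ λ c → c ∈ L × R c x)
         (disjoint : ∀ {x c c′} → R c x → R c′ x → c ≡ c′)
         (sound : ∀ {x c} → R c x → P x) where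

  -- Double counting, one element at a time: if `P x` holds, exactly one class in `L` contributes 1
  -- for `x`; otherwise none does.
  length-filter-partition : ∀ xs →
    + length (filter P? xs) ≡ sumℤ (map (λ c → + length (filter (R? c) xs)) L)
  length-filter-partition []       = sym (sumℤ-zero (λ _ → 0ℤ) (λ _ → refl) L)
  length-filter-partition (x ∷ xs) = begin
    + length (filter P? (x ∷ xs))
      ≡⟨ length-filter-∷ P? x xs ⟩
    indicator (P? x) ℤ.+ + length (filter P? xs)
      ≡⟨ cong₂ ℤ._+_ (indicators (P? x)) (length-filter-partition xs) ⟩
    sumℤ (map (λ c → indicator (R? c x)) L) ℤ.+ sumℤ (map (λ c → + length (filter (R? c) xs)) L)
      ≡⟨ sumℤ-+ _ _ L ⟨
    sumℤ (map (λ c → indicator (R? c x) ℤ.+ + length (filter (R? c) xs)) L)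
      ≡⟨ sumℤ-cong (λ c → length-filter-∷ (R? c) x xs) L ⟨
    sumℤ (map (λ c → + length (filter (R? c) (x ∷ xs))) L)
      ∎
    where
    open ≡-Reasoning
    indicators : (Px? : Dec (P x)) → indicator Px? ≡ sumℤ (map (λ c → indicator (R? c x)) L)
    indicators (yes p) with c , c∈L , r ← covered p = sym (trans
      (sumℤ-single _ L! c∈L (λ {c′} c′≢c → indicator-false (R? c′ x) (λ r′ → c′≢c (disjoint r′ r))))
      (indicator-true (R? c x) r))
    indicators (no ¬p) = sym (sumℤ-zero _ (λ c → indicator-false (R? c x) (¬p ∘ sound)) L)

-- Closure properties of F-positive series

module _ (n : ℕ) where

  FPositive-cong : ∀ {f g : PowerSeries} → (∀ α → f α ≡ g α) → FPositive n g → FPositive n f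
  FPositive-cong f≗g (a , expansion , a≥0) = a , (λ α → trans (f≗g α) (expansion α)) , a≥0

  FPositive-zero : FPositive n (λ _ → 0ℤ)
  FPositive-zero = (λ _ → 0ℤ) ,
    (λ α → sym (sumℤ-zero _ (λ S → ℤₚ.*-zeroˡ (fundamental n S α)) (subsets (n ∸ 1)))) , λ _ → ℤₚ.≤-refl

  FPositive-+ : ∀ {f g : PowerSeries} → FPositive n f → FPositive n g → FPositive n (λ α → f α ℤ.+ g α)
  FPositive-+ (a , f-exp , a≥0) (b , g-exp , b≥0) =
    (λ S → a S ℤ.+ b S) ,
    (λ α → trans (cong₂ ℤ._+_ (f-exp α) (g-exp α)) (trans (sym (sumℤ-+ _ _ (subsets (n ∸ 1))))
      (sumℤ-cong (λ S → sym (ℤₚ.*-distribʳ-+ (fundamental n S α) (a S) (b S))) (subsets (n ∸ 1))))) ,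
    λ S → ℤₚ.+-mono-≤ (a≥0 S) (b≥0 S)

  FPositive-sum : {C : Set} (g : C → PowerSeries) → (∀ c → FPositive n (g c)) →
    ∀ L → FPositive n (λ α → sumℤ (map (λ c → g c α) L))
  FPositive-sum g g-pos []      = FPositive-zero
  FPositive-sum g g-pos (c ∷ L) = FPositive-+ (g-pos c) (FPositive-sum g g-pos L)

  FPositive-fundamental : ∀ S → FPositive n (fundamental n S)
  FPositive-fundamental S = a , expansion , a≥0
    where
    a : Subset (n ∸ 1) → ℤ
    a T = indicator (≡-decᵥ _≟ᵇ_ T S)
    a≥0 : ∀ T → 0ℤ ℤ.≤ a T
    a≥0 T with does (≡-decᵥ _≟ᵇ_ T S)
    ... | true  = ℤ.+≤+ z≤n
    ... | false = ℤ.+≤+ z≤n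
    expansion : IsFExpansion n (fundamental n S) a
    expansion α = sym (trans
      (sumℤ-single _ (subsets-unique (n ∸ 1)) (∈-subsets S)
        (λ {T} T≢S → cong (ℤ._* fundamental n T α) (indicator-false (≡-decᵥ _≟ᵇ_ T S) T≢S)))
      (trans (cong (ℤ._* fundamental n S α) (indicator-true (≡-decᵥ _≟ᵇ_ S S) refl))
             (ℤₚ.*-identityˡ _)))

-- Partition of the proper colorings

members : ∀ {n} → Subset n → List (Fin n)
members []          = []
members (true  ∷ s) = zero ∷ map suc (members s)
members (false ∷ s) = map suc (members s)

length-members : ∀ {n} (s : Subset n) → length (members s) ≡ ∣ s ∣
length-members []          = refl
length-members (true  ∷ s) = cong suc (trans (length-map suc (members s)) (length-members s))
length-members (false ∷ s) = trans (length-map suc (members s)) (length-members s)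

∈-members⁺ : ∀ {n} {s : Subset n} {v} → v ∈ₛ s → v ∈ members s
∈-members⁺ {s = true  ∷ s} here       = here refl
∈-members⁺ {s = true  ∷ s} (there v∈) = there (∈-map⁺ suc (∈-members⁺ v∈))
∈-members⁺ {s = false ∷ s} (there v∈) = ∈-map⁺ suc (∈-members⁺ v∈)

∈-members⁻ : ∀ {n} (s : Subset n) {v} → v ∈ members s → v ∈ₛ s
∈-members⁻ (true  ∷ s) (here refl) = here
∈-members⁻ (true  ∷ s) (there v∈) with _ , u∈ , refl ← ∈-map⁻ suc v∈ = there (∈-members⁻ s u∈)
∈-members⁻ (false ∷ s) v∈         with _ , u∈ , refl ← ∈-map⁻ suc v∈ = there (∈-members⁻ s u∈)

members-unique : ∀ {n} (s : Subset n) → Unique (members s)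
members-unique []          = []
members-unique (true  ∷ s) =
  All.tabulate (λ { v∈ refl → case-zero (∈-map⁻ suc v∈) }) ∷
  Uniqueₚ.map⁺ Finₚ.suc-injective (members-unique s)
  where
  case-zero : ¬ (∃ λ u → u ∈ members s × zero ≡ suc u)
  case-zero (_ , _ , ())
members-unique (false ∷ s) = Uniqueₚ.map⁺ Finₚ.suc-injective (members-unique s)

lookup-ext : {A : Set} {n : ℕ} {v w : Vec A n} → (∀ i → lookup v i ≡ lookup w i) → v ≡ w
lookup-ext {v = v} {w} eq = trans (sym (tabulate∘lookup v)) (trans (tabulate-cong eq) (tabulate∘lookup w))

module _ {n} (H : Hypergraph n) (H-acyclic : Acyclic H) (prime-edges : ∀ e → Prime ∣ edge H e ∣) where

  private
    ∣E∣ : ℕ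
    ∣E∣ = edgeCount H

    order : Vec ℕ ∣E∣ → Fin ∣E∣ → List (Fin n)
    order K e = rotate (lookup K e) (members (edge H e))

    order⊆edge : ∀ K e {v} → v ∈ order K e → v ∈ₛ edge H e
    order⊆edge K e v∈ = ∈-members⁻ (edge H e) (∈-resp-↭ (rotate-↭ (lookup K e) (members (edge H e))) v∈)

    -- Chosen from the rotations alone, without a coloring, so that one descent set serves all
    -- colorings with the same certificate.
    ranking : ∀ K → Σ (Fin n → ℕ) λ r → Injective _≡_ _≡_ r ×
      (∀ e → AllPairs (λ u v → r u < r v) (order K e))
    ranking K = orders-extend H H-acyclic (order K) (order⊆edge K)
      (λ e → rotate-unique (lookup K e) (members-unique (edge H e)))

    r : Vec ℕ ∣E∣ → Fin n → ℕ
    r K = proj₁ (ranking K)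

    r-injective : ∀ K → Injective _≡_ _≡_ (r K)
    r-injective K = proj₁ (proj₂ (ranking K))

    -- Major index congruent to - 1 modulo the size of the edge. The labels `g` are either the
    -- colors or the positions of the vertices in sorted order.
    Selected : Vec ℕ ∣E∣ → (Fin n → ℕ) → Fin ∣E∣ → Set
    Selected K g e = ∣ edge H e ∣ ∣ suc (major (map g (order K e)))

    -- A rotation of every edge, together with a permutation of the vertices and
    -- its inverse.
    Certificate : Set
    Certificate = Vec ℕ ∣E∣ × Vec (Fin n) n × Vec (Fin n) n

    certificates : List Certificate
    certificates = cartesianProduct (vectors (upTo n) ∣E∣)
      (cartesianProduct (vectors (allFin n) n) (vectors (allFin n) n))

    certificates-unique : Unique certificates
    certificates-unique = Uniqueₚ.cartesianProduct⁺ (vectors-unique (Uniqueₚ.upTo⁺ n) ∣E∣)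
      (Uniqueₚ.cartesianProduct⁺ allFin-vectors-unique allFin-vectors-unique)
      where
      allFin-vectors-unique : Unique (vectors (allFin n) n)
      allFin-vectors-unique = vectors-unique (Uniqueₚ.allFin⁺ n) n

    -- No coloring enters: the selection is tested on the standardization `ρ`. The bound on `K`
    -- leaves one representative for each rotation of an edge.
    Valid : Certificate → Set
    Valid (K , ρ , σ) = (∀ e → lookup K e < ∣ edge H e ∣) × Inverses (lookup ρ) (lookup σ) ×
      (∀ e → Selected K (toℕ ∘ lookup ρ) e)

    valid? : Decidable Valid
    valid? (K , ρ , σ) =
      Finₚ.all? (λ e → lookup K e <? ∣ edge H e ∣) ×-dec
      (Finₚ.all? (λ v → lookup σ (lookup ρ v) Finₚ.≟ v) ×-dec
       Finₚ.all? (λ i → lookup ρ (lookup σ i) Finₚ.≟ i)) ×-dec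
      Finₚ.all? (λ e → ∣ edge H e ∣ ∣? suc (major (map (toℕ ∘ lookup ρ) (order K e))))

    strictness : Certificate → Subset (n ∸ 1)
    strictness (K , ρ , σ) = descentSet (r K ∘ lookup σ)

    -- Compatibility expresses that `σ` lists the vertices by color, with ties broken by `r K`.
    Certifies : Certificate → Pred (Coloring n) 0ℓ
    Certifies c@(K , ρ , σ) χ = Valid c × Compatible (strictness c) (reindex (lookup σ) χ)

    certifies? : ∀ c → Decidable (Certifies c)
    certifies? c@(K , ρ , σ) χ = valid? c ×-dec compatible? (strictness c) (reindex (lookup σ) χ)

    -- For a valid certificate only compatibility remains, and reindexing by `σ` turns the series
    -- into one fundamental quasisymmetric function. For an invalid one the series is zero.
    Certifies-FPositive : ∀ c → FPositive n (wordSeries (certifies? c))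
    Certifies-FPositive c@(K , ρ , σ) = by-validity (valid? c)
      where
      empty : ¬ Valid c → ∀ α → wordSeries (certifies? c) α ≡ 0ℤ
      empty ¬valid α with terms (certifies? c) α | ∈-terms⁻ (certifies? c) α
      ... | []    | _     = refl
      ... | _ ∷ _ | sound = contradiction (proj₁ (proj₁ (sound (here refl)))) ¬valid
      by-validity : Dec (Valid c) → FPositive n (wordSeries (certifies? c))
      by-validity (no ¬valid) = FPositive-cong n (empty ¬valid) (FPositive-zero n)
      by-validity (yes valid@(_ , inv , _)) = FPositive-cong n
        (wordSeries-reindex (certifies? c) (compatible? (strictness c)) inv proj₂ (valid ,_))
        (FPositive-fundamental n (strictness c))

    module _ (χ : Coloring n) where

      colorRank : Vec ℕ ∣E∣ → Fin n → ℕ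
      colorRank K = lexicographic (lookup χ) (r K)

      module _ (K : Vec ℕ ∣E∣) {ρ σ : Fin n → Fin n} (inv : Inverses ρ σ) where

        private
          rσ-injective : Injective _≡_ _≡_ (r K ∘ σ)
          rσ-injective {i} {j} eq = trans (sym (proj₂ inv i))
            (trans (cong ρ (r-injective K eq)) (proj₂ inv j))

          lookup-reindex : ∀ i → lookup (reindex σ χ) i ≡ lookup χ (σ i)
          lookup-reindex = lookup∘tabulate _

          <ˡ : ∀ {i j} → lookup (reindex σ χ) i < lookup (reindex σ χ) j →
            colorRank K (σ i) < colorRank K (σ j)
          <ˡ {i} {j} lt = lexicographic-<ˡ (lookup χ) (r K)
            (subst₂ _<_ (lookup-reindex i) (lookup-reindex j) lt)

          <ʳ : ∀ {i j} → lookup (reindex σ χ) i ≡ lookup (reindex σ χ) j → r K (σ i) < r K (σ j) →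
            colorRank K (σ i) < colorRank K (σ j)
          <ʳ {i} {j} eq = lexicographic-<ʳ (lookup χ) (r K)
            (trans (sym (lookup-reindex i)) (trans eq (lookup-reindex j)))

        sorts : Compatible (descentSet (r K ∘ σ)) (reindex σ χ) → Increasing (colorRank K ∘ σ)
        sorts = compatible⇒increasing {w = reindex σ χ} rσ-injective <ˡ <ʳ

        sorted-compatible : Increasing (colorRank K ∘ σ) → Compatible (descentSet (r K ∘ σ)) (reindex σ χ)
        sorted-compatible = increasing⇒compatible {w = reindex σ χ} <ˡ <ʳ

        -- Along `order K e` the ranking `r K` increases, so equal colors become ascents of `ρ` and
        -- the descents are those of the colors.
        major-sorted : Increasing (colorRank K ∘ σ) → ∀ e →
          major (map (lookup χ) (order K e)) ≡ major (map (toℕ ∘ ρ) (order K e))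
        major-sorted inc e = major-cong (order K e) (proj₂ (proj₂ (ranking K)) e) λ ru<rv →
          (λ χv<χu → reflects (lexicographic-<ˡ (lookup χ) (r K) χv<χu)) ,
          (λ χu≤χv → <⇒≤ (reflects ([ lexicographic-<ˡ (lookup χ) (r K)
                                    , (λ χu≡χv → lexicographic-<ʳ (lookup χ) (r K) χu≡χv ru<rv)
                                    ]′ (m≤n⇒m<n∨m≡n χu≤χv))))
          where
          reflects : ∀ {u v} → colorRank K u < colorRank K v → ρ u Fin.< ρ v
          reflects = increasing⇒reflects {f = colorRank K} inv inc

      Certifies⇒Selected : ∀ c → Certifies c χ → ∀ e → Selected (proj₁ c) (lookup χ) e
      Certifies⇒Selected (K , ρ , σ) ((_ , inv , selected) , compatible) e =
        subst (λ m → ∣ edge H e ∣ ∣ suc m) (sym (major-sorted K inv (sorts K inv compatible) e)) (selected e)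

      -- On a monochromatic edge the major index is 0, so the size of the edge would divide 1, which
      -- no prime does.
      Selected⇒not-monochromatic : ∀ K e → Selected K (lookup χ) e → ¬ Monochromatic χ (edge H e)
      Selected⇒not-monochromatic K e selected mono =
        ¬prime[1] (subst Prime (∣1⇒≡1 (subst (λ m → ∣ edge H e ∣ ∣ suc m) major≡0 selected)) (prime-edges e))
        where
        constant : ∀ {b c} → b ∈ map (lookup χ) (order K e) → c ∈ map (lookup χ) (order K e) → b ≡ c
        constant b∈ c∈ with u , u∈ , refl ← ∈-map⁻ (lookup χ) b∈ | v , v∈ , refl ← ∈-map⁻ (lookup χ) c∈ =
          mono u (order⊆edge K e u∈) v (order⊆edge K e v∈)
        major≡0 : major (map (lookup χ) (order K e)) ≡ 0
        major≡0 = major-constant _ constant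

      Certifies⇒Proper : ∀ {c} → Certifies c χ → Proper H χ
      Certifies⇒Proper {c} cert e = Selected⇒not-monochromatic (proj₁ c) e (Certifies⇒Selected c cert e)

      module _ (proper : Proper H χ) (e : Fin ∣E∣) where

        word : List ℕ
        word = map (lookup χ) (members (edge H e))

        length-word : length word ≡ ∣ edge H e ∣
        length-word = trans (length-map (lookup χ) (members (edge H e))) (length-members (edge H e))

        word-nonconstant : cyclicDescents word ≢ 0
        word-nonconstant eq = proper e λ u u∈ v v∈ →
          cyclicDescents≡0⇒constant word eq
            (∈-map⁺ (lookup χ) (∈-members⁺ u∈)) (∈-map⁺ (lookup χ) (∈-members⁺ v∈))

        selected-rotation : ∃ λ k → k < ∣ edge H e ∣ × ∣ edge H e ∣ ∣ suc (major (rotate k word))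
        selected-rotation = rotation-exists (prime-edges e) word length-word word-nonconstant

        selected-rotation-unique : ∀ {k k′} → k < ∣ edge H e ∣ → k′ < ∣ edge H e ∣ →
          ∣ edge H e ∣ ∣ suc (major (rotate k word)) → ∣ edge H e ∣ ∣ suc (major (rotate k′ word)) → k ≡ k′
        selected-rotation-unique = rotation-unique (prime-edges e) word length-word word-nonconstant

      word-rotate : ∀ k e → map (lookup χ) (rotate k (members (edge H e))) ≡
        rotate k (map (lookup χ) (members (edge H e)))
      word-rotate k e = map-rotate (lookup χ) k (members (edge H e))

      -- Each edge carries a nonconstant word of prime length, which supplies its rotation. These
      -- rotations fix `r K`, and sorting the vertices by `colorRank K` supplies the permutation.
      Proper⇒Certifies : Proper H χ → ∃ λ c → c ∈ certificates × Certifies c χ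
      Proper⇒Certifies proper = go (sorting (lexicographic-injective (lookup χ) (r K) (r-injective K)))
        where
        K : Vec ℕ ∣E∣
        K = tabulate λ e → proj₁ (selected-rotation proper e)

        K-bounded : ∀ e → lookup K e < ∣ edge H e ∣
        K-bounded e = subst (_< ∣ edge H e ∣) (sym (lookup∘tabulate _ e))
          (proj₁ (proj₂ (selected-rotation proper e)))

        K-selected : ∀ e → Selected K (lookup χ) e
        K-selected e = subst (λ w → ∣ edge H e ∣ ∣ suc (major w)) (sym (word-rotate (lookup K e) e))
          (subst (λ k → ∣ edge H e ∣ ∣ suc (major (rotate k (word proper e)))) (sym (lookup∘tabulate _ e))
            (proj₂ (proj₂ (selected-rotation proper e))))

        go : (∃₂ λ ρ σ → Inverses ρ σ × Increasing (colorRank K ∘ σ)) →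
          ∃ λ c → c ∈ certificates × Certifies c χ
        go (ρ , σ , inv , inc) = (K , tabulate ρ , tabulate σ) ,
          ∈-cartesianProduct⁺
            -- A rotation is smaller than the size of its edge, which is at most `n`, so `upTo n`
            -- contains it.
            (∈-vectors⁺ (Allᵥ-lookup⁻ λ e → ∈-upTo⁺ (<-≤-trans (K-bounded e) (∣p∣≤n (edge H e)))))
            (∈-cartesianProduct⁺ (∈-allFin-vectors _) (∈-allFin-vectors _)) ,
          (K-bounded , inv′ , λ e →
            subst (λ m → ∣ edge H e ∣ ∣ suc m) (major-sorted K inv′ inc′ e) (K-selected e)) ,
          sorted-compatible K inv′ inc′
          where
          ∈-allFin-vectors : ∀ τ → τ ∈ vectors (allFin n) n
          ∈-allFin-vectors τ = ∈-vectors⁺ (Allᵥ-lookup⁻ λ i → ∈-allFin (lookup τ i))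
          inv′ : Inverses (lookup (tabulate ρ)) (lookup (tabulate σ))
          inv′ =
            (λ v → trans (lookup∘tabulate σ _) (trans (cong σ (lookup∘tabulate ρ v)) (proj₁ inv v))) ,
            (λ i → trans (lookup∘tabulate ρ _) (trans (cong ρ (lookup∘tabulate σ i)) (proj₂ inv i)))
          inc′ : Increasing (colorRank K ∘ lookup (tabulate σ))
          inc′ {i} {j} i<j = subst₂ (λ u v → colorRank K u < colorRank K v)
            (sym (lookup∘tabulate σ i)) (sym (lookup∘tabulate σ j)) (inc i<j)

      -- Both certificates select a rotation of each word of colors, and only one rotation
      -- qualifies, so `K` and `K′` agree. Then both permutations sort the same injective ranking
      -- `colorRank K`.
      Certifies-unique : ∀ {c c′} → Certifies c χ → Certifies c′ χ → c ≡ c′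
      Certifies-unique {c@(K , ρ , σ)} {c′@(K′ , ρ′ , σ′)}
        cert@((K-bounded , inv , _) , compatible) cert′@((K′-bounded , inv′ , _) , compatible′)
        = combine (lookup-ext K≗K′)
        where
        selected : ∀ c → Certifies c χ → ∀ e →
          ∣ edge H e ∣ ∣ suc (major (rotate (lookup (proj₁ c) e) (map (lookup χ) (members (edge H e)))))
        selected c cert e = subst (λ w → ∣ edge H e ∣ ∣ suc (major w))
          (word-rotate (lookup (proj₁ c) e) e) (Certifies⇒Selected c cert e)

        K≗K′ : ∀ e → lookup K e ≡ lookup K′ e
        K≗K′ e = selected-rotation-unique (Certifies⇒Proper {c} cert) e (K-bounded e) (K′-bounded e)
          (selected c cert e) (selected c′ cert′ e)

        combine : K ≡ K′ → c ≡ c′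
        combine refl
          with ρ≗ρ′ , σ≗σ′ ← increasing-unique {f = colorRank K} inv inv′
                               (sorts K inv compatible) (sorts K inv′ compatible′)
          = cong₂ (λ ρ σ → K , ρ , σ) (lookup-ext ρ≗ρ′) (lookup-ext σ≗σ′)

  acyclic⇒FPositive : FPositive n (chromaticSymmetricFunction H)
  acyclic⇒FPositive = FPositive-cong n partition
    (FPositive-sum n (λ c → wordSeries (certifies? c)) Certifies-FPositive certificates)
    where
    partition : ∀ α → chromaticSymmetricFunction H α ≡
      sumℤ (map (λ c → wordSeries (certifies? c) α) certificates)
    -- Both sides filter the same list of words, and each filter also demands the monomial `α`;
    -- `content` carries this condition along.
    partition α = length-filter-partition _ _ certificates-unique
      (λ {χ} (proper , content) →
        let c , c∈ , cert = Proper⇒Certifies χ proper in c , c∈ , cert , content)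
      (λ {χ} (cert , _) (cert′ , _) → Certifies-unique χ cert cert′)
      (λ {χ} {c} (cert , content) → Certifies⇒Proper χ {c} cert , content)
      (vectors (upTo (length α)) n)

theorem3p3 : (n : ℕ) (H : Hypergraph n) → IsHypertree H →
    (∀ e → Prime ∣ edge H e ∣) →
    FPositive n (chromaticSymmetricFunction H)
theorem3p3 n H H-hypertree prime-edges = acyclic⇒FPositive H (acyclic H-hypertree) prime-edges
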